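{- For any partitions $\lambda,\mu$ and any $1\le m<n$, $$\mathbb{F}_{\lambda/\mu}(\kappa_1,\dots,\kappa_n\mid\Xi,\mathsf{S})=\sum_{\nu}\mathbb{F}_{\lambda/\nu}(\kappa_1,\dots,\kappa_m\mid\Xi,\mathsf{S})\,\mathbb{F}_{\nu/\mu}(\kappa_{m+1},\dots,\kappa_n\mid\tau^m_{\mathsf{S}}\Xi,\tau^m_{\Xi}\mathsf{S}),$$ where the sum is over all partitions $\nu$ and is finite (only finitely many terms are nonzero).
   Context: Fix a generic parameter $q$, and write $(x;q)_n:=\prod_{i=1}^n(1-xq^{i-1})$, $(x;q)_0:=1$. A partition is a weakly decreasing sequence $\lambda=(\lambda_1\ge\lambda_2\ge\dots\ge0)$ of nonnegative integers with finitely many nonzero entries; $l(\lambda)$ is the number of nonzero parts and $\lambda'$ is the conjugate partition, so the number of parts of $\lambda'$ equal to $j$ is $m_j(\lambda')=\lambda_j-\lambda_{j+1}$. Let $\Xi=(\xi_0,\xi_1,\dots)$ and $\mathsf{S}=(s_0,s_1,\dots)$ be sequences of generic parameters, with fixed square roots $\sqrt{\xi_i},\sqrt{s_i}$. For $k\ge0$ put $\xi_i^{(k)}:=\sqrt{\xi_{i+k}s_{i+k}\xi_i/s_i}$, $s_i^{(k)}:=\sqrt{s_{i+k}\xi_{i+k}s_i/\xi_i}$ (with these roots formed from the fixed ones), and $\tau^k_{\mathsf{S}}\Xi:=(\xi^{(k)}_0,\xi^{(k)}_1,\dots)$, $\tau^k_{\Xi}\mathsf{S}:=(s^{(k)}_0,s^{(k)}_1,\dots)$.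 Square roots for shifted sequences are taken compatibly, so that performing the $l$-fold shift of the pair $(\tau^k_{\mathsf{S}}\Xi,\tau^k_{\Xi}\mathsf{S})$ gives $(\tau^{k+l}_{\mathsf{S}}\Xi,\tau^{k+l}_{\Xi}\mathsf{S})$. Vertex weights: for $i,j,k,l\in\mathbb{Z}_{\ge0}$ (labels of the bottom, left, top, right edge), $$W_{t,s}(i,j;k,l):=\mathbf{1}_{i+j=k+l}\,\mathbf{1}_{i\ge l}\,(s^2/t^2)^{l}\frac{(s^2/t^2;q)_{i-l}(t^2;q)_l}{(s^2;q)_i}\frac{(q;q)_i}{(q;q)_{i-l}(q;q)_l},$$ which depends only on $t^2,s^2$. Partition function: for $a_1,\dots,a_n\in\mathbb{Z}_{\ge0}$ and $L>l(\lambda),l(\mu)$, $$ZW^{(a_1,\dots,a_n)}_{\lambda/\mu}(\kappa_1,\dots,\kappa_n\mid\Xi,\mathsf{S}):=\sum\prod_{r=1}^n\prod_{c=1}^L W_{t_{r,c},\,s^{(r)}_c}(v_{r,c},h_{r,c-1};v_{r-1,c},h_{r,c}),\qquad t_{r,c}^2=\frac{\xi_{r+c}s_{r+c}}{\kappa_r},$$ where the sum is over all nonnegative integers $v_{r,c}$ ($0\le r\le n$, $1\le c\le L$) and $h_{r,c}$ ($1\le r\le n$, $0\le c\le L$) subject to $v_{0,c}=m_c(\lambda')$, $v_{n,c}=m_c(\mu')$, $h_{r,0}=a_r$, $h_{r,L}=0$; the result does not depend on $L$. Set $$\mathbb{F}^{\mathsf s}_{\lambda/\mu}(\kappa_1,\dots,\kappa_n\mid\Xi,\mathsf{S}):=\sum_{a_1+\dots+a_n=\lambda_1-\mu_1}\Bigl(\prod_{i=1}^n(\kappa_is_0/\xi_0)^{a_i}\frac{(\kappa_i^{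 -1}s_i\xi_i;q)_{a_i}}{(q;q)_{a_i}}\Bigr)ZW^{(a_1,\dots,a_n)}_{\lambda/\mu}(\kappa_1,\dots,\kappa_n\mid\Xi,\mathsf{S}),$$ $$\mathbb{F}_{\lambda/\mu}(\kappa_1,\dots,\kappa_n\mid\Xi,\mathsf{S}):=\frac{(-\tau^n_\Xi\mathsf{S})^{\mu}}{(-\mathsf{S})^{\lambda}}\frac{\mathsf{c}_{\tau^n_\Xi\mathsf{S}}(\mu)}{\mathsf{c}_{\mathsf{S}}(\lambda)}\,\mathbb{F}^{\mathsf s}_{\lambda/\mu}(\kappa_1,\dots,\kappa_n\mid\Xi,\mathsf{S}),$$ where $\mathsf{c}_{\mathsf{S}}(\lambda):=\prod_{i\ge1}\frac{(s_i^2;q)_{\lambda_i-\lambda_{i+1}}}{(q;q)_{\lambda_i-\lambda_{i+1}}}$ and $(-\mathsf{S})^\lambda:=\prod_{i\ge1}(-s_{i-1})^{\lambda_i}$ (and likewise with $\mathsf S$ replaced by another sequence). -}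

module Defs where

open import Algebra.Apartness.Bundles using (HeytingField; HeytingCommutativeRing)
open import Algebra.Bundles using (CommutativeRing; Semiring)
open import Data.Bool.Base using (if_then_else_)
open import Data.Fin.Base as Fin using (Fin; toℕ; fromℕ; inject₁)
open import Data.List.Base as List using (List; []; _∷_; upTo; cartesianProductWith)
open import Data.List.Membership.Propositional using (_∉_)
open import Data.List.Relation.Unary.All using (All)
open import Data.List.Relation.Unary.Linked using (Linked; [-]; _∷_)
open import Data.List.Relation.Unary.Unique.Propositional using (Unique)
open import Data.Nat.Base as ℕ using (ℕ; zero; suc; _∸_; _≤_)
import Data.Nat.Properties as ℕₚ
open import Data.Nat.Tactic.RingSolver using (solve-∀)
open import Data.Product.Base using (_×_; _,_)
open import Data.Vec.Base as Vec using (Vec; []; _∷_; lookup; tabulate)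
import Data.Vec.Properties as Vecₚ
open import Level using (Level)
open import Relation.Binary.PropositionalEquality as ≡ using (_≡_)
open import Relation.Nullary.Decidable.Core using (Dec; does; _×-dec_)

------------------------------------------------------------------------
-- Fields

-- Inversion is a total operation, but nothing is assumed about x ⁻¹
-- unless x # 0#.
record Field (c ℓ₁ ℓ₂ : Level) : Set (Level.suc (c Level.⊔ ℓ₁ Level.⊔ ℓ₂)) where
  infix 9 _⁻¹
  infixl 7 _/_
  field
    heytingField : HeytingField c ℓ₁ ℓ₂

  open HeytingField heytingField public

  field
    _⁻¹        : Carrier → Carrier
    ⁻¹-cong    : ∀ {x y} → x ≈ y → x ⁻¹ ≈ y ⁻¹
    ⁻¹-inverse : ∀ {x} → x # 0# → x * x ⁻¹ ≈ 1#

  _/_ : Carrier → Carrier → Carrier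
  x / y = x * y ⁻¹

  commutativeRing : CommutativeRing c ℓ₁
  commutativeRing = HeytingCommutativeRing.commutativeRing heytingCommutativeRing

------------------------------------------------------------------------
-- Partitions

record Partition : Set where
  constructor mkPartition
  field
    parts      : List ℕ
    decreasing : Linked ℕ._≥_ parts
    positive   : All (0 ℕ.<_) parts

nth : List ℕ → ℕ → ℕ
nth []       _       = 0
nth (x ∷ _)  zero    = x
nth (_ ∷ xs) (suc i) = nth xs i

-- Indices start at 0: part la i is λ_{i+1}.
part : Partition → ℕ → ℕ
part la = nth (Partition.parts la)

len : Partition → ℕ
len la = List.length (Partition.parts la)

-- m_{i+1}(λ′) = λ_{i+1} - λ_{i+2}, the number of parts of the conjugate
-- partition λ′ equal to i + 1.
mult′ : Partition → ℕ → ℕ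
mult′ la i = part la i ∸ part la (suc i)

------------------------------------------------------------------------
-- Grid configurations

-- All vectors of length n with entries taken from xs.
vecs : ∀ {a} {A : Set a} → List A → (n : ℕ) → List (Vec A n)
vecs xs zero    = [] ∷ []
vecs xs (suc n) = cartesianProductWith _∷_ xs (vecs xs n)

-- Vertical labels v_{r,c} (0 ≤ r ≤ n, 1 ≤ c ≤ L) and horizontal labels
-- h_{r,c} (1 ≤ r ≤ n, 0 ≤ c ≤ L), listed row by row.
Vertical Horizontal : ℕ → ℕ → Set
Vertical   n L = Vec (Vec ℕ L) (suc n)
Horizontal n L = Vec (Vec ℕ (suc L)) n

-- The labels v_{r,c}, h_{r,c-1}, v_{r-1,c}, h_{r,c} around the vertex in
-- row r and column c, where r and c are one more than the Fin arguments.
module _ {n L : ℕ} (v : Vertical n L) (h : Horizontal n L) (r : Fin n) (c : Fin L) where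
  bottom left top right : ℕ
  bottom = lookup (lookup v (Fin.suc r)) c
  left   = lookup (lookup h r) (inject₁ c)
  top    = lookup (lookup v (inject₁ r)) c
  right  = lookup (lookup h r) (Fin.suc c)

Boundary : ∀ {n L} → Partition → Partition → Vec ℕ n → Vertical n L → Horizontal n L → Set
Boundary {n} {L} la mu a v h =
  lookup v Fin.zero ≡ tabulate (λ c → mult′ la (toℕ c)) ×
  lookup v (fromℕ n) ≡ tabulate (λ c → mult′ mu (toℕ c)) ×
  Vec.map (λ g → lookup g Fin.zero) h ≡ a ×
  Vec.map (λ g → lookup g (fromℕ L)) h ≡ Vec.replicate n 0

boundary? : ∀ {n L} la mu (a : Vec ℕ n) (v : Vertical n L) (h : Horizontal n L) →
            Dec (Boundary la mu a v h)
boundary? la mu a v h =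
  Vecₚ.≡-dec ℕₚ._≟_ _ _ ×-dec Vecₚ.≡-dec ℕₚ._≟_ _ _ ×-dec
  Vecₚ.≡-dec ℕₚ._≟_ _ _ ×-dec Vecₚ.≡-dec ℕₚ._≟_ _ _

-- Conservation i + j = k + l at every vertex, which nonzero weights force,
-- bounds all labels by λ₁. Hence the sum over all configurations may be
-- restricted to labels ≤ λ₁ without losing nonzero terms.
module _ where
  private
    flow : ∀ {L} (x y : Vec ℕ L) (g : Vec ℕ (suc L)) →
           (∀ c → lookup y c ℕ.+ lookup g (inject₁ c) ≡ lookup x c ℕ.+ lookup g (Fin.suc c)) →
           lookup g (fromℕ L) ≡ 0 → Vec.sum y ℕ.+ lookup g Fin.zero ≡ Vec.sum x
    flow [] [] (_ ∷ []) _ g≡0 = g≡0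
    flow (x ∷ xs) (y ∷ ys) (g ∷ g′ ∷ gs) eq g≡0 = begin
      (y ℕ.+ Vec.sum ys) ℕ.+ g     ≡⟨ swap y (Vec.sum ys) g ⟩
      (y ℕ.+ g) ℕ.+ Vec.sum ys     ≡⟨ ≡.cong (ℕ._+ Vec.sum ys) (eq Fin.zero) ⟩
      (x ℕ.+ g′) ℕ.+ Vec.sum ys    ≡⟨ rot x g′ (Vec.sum ys) ⟩
      x ℕ.+ (Vec.sum ys ℕ.+ g′)    ≡⟨ ≡.cong (x ℕ.+_) (flow xs ys (g′ ∷ gs) (λ c → eq (Fin.suc c)) g≡0) ⟩
      x ℕ.+ Vec.sum xs             ∎
      where
      open ≡.≡-Reasoning
      swap : ∀ a b c → (a ℕ.+ b) ℕ.+ c ≡ (a ℕ.+ c) ℕ.+ b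
      swap = solve-∀
      rot : ∀ a b c → (a ℕ.+ b) ℕ.+ c ≡ a ℕ.+ (c ℕ.+ b)
      rot = solve-∀

    horizontal≤ : ∀ {L} (x y : Vec ℕ L) (g : Vec ℕ (suc L)) →
           (∀ c → lookup y c ℕ.+ lookup g (inject₁ c) ≡ lookup x c ℕ.+ lookup g (Fin.suc c)) →
           lookup g (fromℕ L) ≡ 0 → ∀ c → lookup g c ≤ Vec.sum x
    horizontal≤ x y g eq g≡0 Fin.zero =
      ℕₚ.≤-trans (ℕₚ.m≤n+m _ (Vec.sum y)) (ℕₚ.≤-reflexive (flow x y g eq g≡0))
    horizontal≤ (x ∷ xs) (_ ∷ ys) (_ ∷ gs) eq g≡0 (Fin.suc c) =
      ℕₚ.m≤n⇒m≤o+n x (horizontal≤ xs ys gs (λ d → eq (Fin.suc d)) g≡0 c)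

    lookup≤sum : ∀ {L} (x : Vec ℕ L) c → lookup x c ≤ Vec.sum x
    lookup≤sum (x ∷ xs) Fin.zero    = ℕₚ.m≤m+n x _
    lookup≤sum (x ∷ xs) (Fin.suc c) = ℕₚ.m≤n⇒m≤o+n x (lookup≤sum xs c)

    telescope : ∀ L (f : ℕ → ℕ) → (∀ i → f (suc i) ≤ f i) →
                Vec.sum (tabulate {n = L} (λ c → f (toℕ c) ∸ f (suc (toℕ c)))) ≤ f 0
    telescope zero    f dec = ℕ.z≤n
    telescope (suc L) f dec = ℕₚ.≤-trans
      (ℕₚ.+-monoʳ-≤ (f 0 ∸ f 1) (telescope L (λ i → f (suc i)) (λ i → dec (suc i))))
      (ℕₚ.≤-reflexive (ℕₚ.m∸n+n≡m (dec 0)))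

    rowSum : ∀ {n L} (v : Vertical n L) (h : Horizontal n L) →
             (∀ r c → bottom v h r c ℕ.+ left v h r c ≡ top v h r c ℕ.+ right v h r c) →
             Vec.map (λ g → lookup g (fromℕ L)) h ≡ Vec.replicate n 0 →
             (∀ r → Vec.sum (lookup v r) ≤ Vec.sum (lookup v Fin.zero)) ×
             (∀ r c → lookup (lookup h r) c ≤ Vec.sum (lookup v Fin.zero))
    rowSum (x ∷ []) [] eq h≡0 = (λ { Fin.zero → ℕₚ.≤-refl }) , λ ()
    rowSum (x ∷ y ∷ v) (g ∷ h) eq h≡0
      with Vecₚ.∷-injective h≡0
    ... | g≡0 , h≡0′ with rowSum (y ∷ v) h (λ r → eq (Fin.suc r)) h≡0′
    ... | vs , hs =
      (λ { Fin.zero → ℕₚ.≤-refl ; (Fin.suc r) → ℕₚ.≤-trans (vs r) y≤x }) ,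
      (λ { Fin.zero → horizontal≤ x y g (eq Fin.zero) g≡0
         ; (Fin.suc r) c → ℕₚ.≤-trans (hs r c) y≤x })
      where
      y≤x : Vec.sum y ≤ Vec.sum x
      y≤x = ℕₚ.≤-trans (ℕₚ.m≤m+n _ _) (ℕₚ.≤-reflexive (flow x y g (eq Fin.zero) g≡0))

  part-decreasing : ∀ la i → part la (suc i) ≤ part la i
  part-decreasing la = go (Partition.decreasing la)
    where
    go : ∀ {xs} → Linked ℕ._≥_ xs → ∀ i → nth xs (suc i) ≤ nth xs i
    go {[]} _ _                = ℕ.z≤n
    go [-] _                   = ℕ.z≤n
    go (x≥y ∷ _)  zero         = x≥y
    go (_ ∷ link) (suc i)      = go link i

  labels≤λ₁ : ∀ {n L} {la mu} {a : Vec ℕ n} (v : Vertical n L) (h : Horizontal n L) →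
              Boundary la mu a v h →
              (∀ r c → bottom v h r c ℕ.+ left v h r c ≡ top v h r c ℕ.+ right v h r c) →
              (∀ r c → lookup (lookup v r) c ≤ part la 0) ×
              (∀ r c → lookup (lookup h r) c ≤ part la 0)
  labels≤λ₁ {L = L} {la} v h (v₀≡ , _ , _ , h≡0) eq with rowSum v h eq h≡0
  ... | vs , hs =
    (λ r c → ℕₚ.≤-trans (lookup≤sum (lookup v r) c) (ℕₚ.≤-trans (vs r) v₀≤)) ,
    (λ r c → ℕₚ.≤-trans (hs r c) v₀≤)
    where
    v₀≤ : Vec.sum (lookup v Fin.zero) ≤ part la 0
    v₀≤ = ≡.subst (λ w → Vec.sum w ≤ part la 0) (≡.sym v₀≡)
            (telescope L (part la) (part-decreasing la))

------------------------------------------------------------------------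

module SpinQWhittaker {c ℓ₁ ℓ₂ : Level} (K : Field c ℓ₁ ℓ₂) where

  open Field K
  open import Algebra.Definitions.RawSemiring (Semiring.rawSemiring (CommutativeRing.semiring commutativeRing)) public
    using (_^_; product)

  ∑ : ∀ {a} {A : Set a} → List A → (A → Carrier) → Carrier
  ∑ xs f = List.foldr (λ x acc → f x + acc) 0# xs

  𝟙 : ∀ {p} {P : Set p} → Dec P → Carrier
  𝟙 P? = if does P? then 1# else 0#

  -- The sum of f over all of A has only finitely many nonzero terms and
  -- equals x.
  record FiniteSum {a} {A : Set a} (f : A → Carrier) (x : Carrier) : Set (a Level.⊔ ℓ₁) where
    field
      support : List A
      unique  : Unique support
      outside : ∀ y → y ∉ support → f y ≈ 0#
      total   : x ≈ ∑ support f

  -- poch q x n is (x;q)_n.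
  poch : Carrier → Carrier → ℕ → Carrier
  poch q x n = product {n} (λ i → 1# - x * q ^ toℕ i)

  ----------------------------------------------------------------------
  -- The parameter sequences and their shifts

  -- A pair of sequences (Ξ , S) together with choices of the roots
  -- √(ξ_i s_i) and √(ξ_i / s_i), which is what the shifts involve.
  record Parameters : Set c where
    field
      ξ s √ξs √ξ/s : ℕ → Carrier

  open Parameters

  fromRoots : (√ξ √s : ℕ → Carrier) → Parameters
  fromRoots √ξ √s = record
    { ξ    = λ i → √ξ i ^ 2
    ; s    = λ i → √s i ^ 2
    ; √ξs  = λ i → √ξ i * √s i
    ; √ξ/s = λ i → √ξ i / √s i
    }

  -- ξ^{(k)}_i = √(ξ_{i+k} s_{i+k}) √(ξ_i / s_i) and
  -- s^{(k)}_i = √(ξ_{i+k} s_{i+k}) / √(ξ_i / s_i).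
  -- As ξ^{(k)}_i s^{(k)}_i = ξ_{i+k} s_{i+k} and ξ^{(k)}_i / s^{(k)}_i = ξ_i / s_i,
  -- the shifted pair inherits roots, for which shifting by k and then by l
  -- is shifting by k + l (τ-τ below).
  τ : ℕ → Parameters → Parameters
  τ k P = record
    { ξ    = λ i → √ξs P (i ℕ.+ k) * √ξ/s P i
    ; s    = λ i → √ξs P (i ℕ.+ k) / √ξ/s P i
    ; √ξs  = λ i → √ξs P (i ℕ.+ k)
    ; √ξ/s = √ξ/s P
    }

  τ-τ : ∀ k l P i → ξ (τ l (τ k P)) i ≡ ξ (τ (k ℕ.+ l) P) i × s (τ l (τ k P)) i ≡ s (τ (k ℕ.+ l) P) i
  τ-τ k l P i = ≡.cong (λ j → √ξs P j * √ξ/s P i) eq , ≡.cong (λ j → √ξs P j / √ξ/s P i) eq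
    where
    eq : i ℕ.+ l ℕ.+ k ≡ i ℕ.+ (k ℕ.+ l)
    eq = ≡.trans (ℕₚ.+-assoc i l k) (≡.cong (i ℕ.+_) (ℕₚ.+-comm l k))

  -- The denominators occurring below do not vanish.
  record Generic {n} (q : Carrier) (√ξ √s : ℕ → Carrier) (κ : Vec Carrier n) : Set ℓ₂ where
    field
      q-generic : ∀ j → q ^ suc j # 1#
      √ξ#0      : ∀ i → √ξ i # 0#
      √s#0      : ∀ i → √s i # 0#
      κ#0       : ∀ i → lookup κ i # 0#
      s-generic : ∀ k i j → s (τ k (fromRoots √ξ √s)) i ^ 2 * q ^ j # 1#

  ----------------------------------------------------------------------
  -- The functions 𝔽

  -- The vertex weight W_{t,s}(i,j;k,l), as a function of t² and s².
  W : (q t² s² : Carrier) (i j k l : ℕ) → Carrier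
  W q t² s² i j k l =
    𝟙 (i ℕ.+ j ℕₚ.≟ k ℕ.+ l) * 𝟙 (l ℕₚ.≤? i) *
    ((s² / t²) ^ l *
     ((poch q (s² / t²) (i ∸ l) * poch q t² l) / poch q s² i) *
     (poch q q i / (poch q q (i ∸ l) * poch q q l)))

  -- The partition function on L columns. Labels are summed over 0, …, λ₁;
  -- by labels≤λ₁ all other configurations have weight 0.
  ZW : Carrier → ∀ {n} → ℕ → Vec ℕ n → Partition → Partition → Vec Carrier n → Parameters → Carrier
  ZW q {n} L a la mu κ P =
    ∑ (vecs (vecs labels L) (suc n)) λ v →
    ∑ (vecs (vecs labels (suc L)) n) λ h →
      𝟙 (boundary? la mu a v h) *
      product {n} λ r → product {L} λ c →
        W q (t² (suc (toℕ r)) (suc (toℕ c)) (lookup κ r))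
            (s (τ (suc (toℕ r)) P) (suc (toℕ c)) ^ 2)
            (bottom v h r c) (left v h r c) (top v h r c) (right v h r c)
    where
    labels = upTo (suc (part la 0))
    t² : ℕ → ℕ → Carrier → Carrier
    t² r c κᵣ = ξ P (r ℕ.+ c) * s P (r ℕ.+ c) / κᵣ

  -- The condition a₁ + … + a_n = λ₁ - μ₁ is an equation of integers: if
  -- λ₁ < μ₁, the sum is empty.
  𝔽ˢ : Carrier → ∀ {n} → Partition → Partition → Vec Carrier n → Parameters → Carrier
  𝔽ˢ q {n} la mu κ P =
    ∑ (vecs (upTo (suc (part la 0))) n) λ a →
      𝟙 (Vec.sum a ℕ.+ part mu 0 ℕₚ.≟ part la 0) *
      product {n} (λ i → let κᵢ = lookup κ i
                             aᵢ = lookup a i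
                             i′ = suc (toℕ i) in
        (κᵢ * s P 0 / ξ P 0) ^ aᵢ *
        (poch q (κᵢ ⁻¹ * s P i′ * ξ P i′) aᵢ / poch q q aᵢ)) *
      ZW q (suc (len la ℕ.⊔ len mu)) a la mu κ P

  -- The factors with i > l(λ) of the infinite products defining 𝖼 and
  -- (-S)^λ are 1.
  𝖼 : Carrier → (ℕ → Carrier) → Partition → Carrier
  𝖼 q S la = product {len la} λ i →
    poch q (S (suc (toℕ i)) ^ 2) (mult′ la (toℕ i)) / poch q q (mult′ la (toℕ i))

  negPow : (ℕ → Carrier) → Partition → Carrier
  negPow S la = product {len la} λ i → (- S (toℕ i)) ^ part la (toℕ i)

  𝔽 : Carrier → ∀ {n} → Partition → Partition → Vec Carrier n → Parameters → Carrier
  𝔽 q {n} la mu κ P =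
    (negPow (s (τ n P)) mu / negPow (s P) la) *
    (𝖼 q (s (τ n P)) mu / 𝖼 q (s P) la) *
    𝔽ˢ q la mu κ P

{-# OPTIONS --safe #-}
module Submission where

-- By conservation, the horizontal label to the right of column c in a row with
-- the partition λ above it and ν below it is λ_{c+1} - ν_{c+1}. So ν determines
-- the left label λ₁ - ν₁ as well, the constraint a₁ + … + a_n = λ₁ - μ₁ is
-- automatic, and 𝔽ˢ is an entry of a product of n transfer matrices indexed by
-- partitions. Such an entry vanishes unless ν ⊆ λ, which makes the product
-- independent of the number of columns and of the bound on the labels. Row r for
-- the parameters shifted by m is row m + r for the original ones, because the
-- shift preserves s₀ / ξ₀ and turns ξ_i s_i into ξ_{i+m} s_{i+m}. Hence the
-- branching rule is associativity of the matrix product, and the prefactors of 𝔽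
-- attached to the intermediate partition cancel.

open import Defs
open import Algebra.Bundles using (CommutativeRing)
import Algebra.Apartness.Properties.HeytingCommutativeRing as ApartnessProperties
import Algebra.Properties.Monoid.Sum as MonoidSum
import Algebra.Properties.Semiring.Exp as Exp
import Algebra.Solver.CommutativeMonoid as MonoidSolver
open import Data.Empty using (⊥-elim)
open import Data.Fin.Base as Fin using (Fin; toℕ; fromℕ; inject₁; _↑ˡ_; _↑ʳ_)
import Data.Fin.Properties as Finₚ
open import Data.List.Base as List using (List; []; _∷_; upTo; cartesianProductWith)
import Data.List.Membership.DecPropositional as DecMembership
open import Data.List.Membership.Propositional using (_∈_; _∉_)
open import Data.List.Membership.Propositional.Properties
  using (∈-cartesianProductWith⁺; ∈-map⁺; ∈-upTo⁺)
open import Data.List.Relation.Unary.All as All using ([]; _∷_)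
open import Data.List.Relation.Unary.AllPairs using ([]; _∷_)
open import Data.List.Relation.Unary.Any using (here; there)
open import Data.List.Relation.Unary.Linked as Linked using ([]; [-]; _∷_)
open import Data.List.Relation.Unary.Unique.Propositional using (Unique)
import Data.List.Relation.Unary.Unique.Propositional.Properties as Unique
open import Data.Nat.Base as ℕ using (ℕ; zero; suc; _∸_; _≤_; _⊔_; z≤n; s≤s; z<s)
import Data.Nat.Properties as ℕₚ
open import Data.Product.Base using (_×_; _,_; proj₂)
open import Data.Unit.Base using (⊤; tt)
open import Data.Vec.Base as Vec using (Vec; []; _∷_; _++_; lookup; replicate; sum; tabulate)
import Data.Vec.Properties as Vecₚ
open import Data.Vec.Relation.Unary.All as VecAll using ([]; _∷_)
open import Function.Base using (_∘_)
import Level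
open import Relation.Binary.Definitions using (DecidableEquality)
open import Relation.Binary.PropositionalEquality as ≡ using (_≡_; _≢_)
open import Relation.Nullary using (Dec; yes; no; ¬_)
open import Relation.Nullary.Decidable using (_×-dec_)

-- Multiplicity vectors and their domination order

module Diagrams where

  open ≡ using (refl; cong; cong₂)
  open import Data.Nat.Base using (_+_)
  open ℕₚ

  private variable
    L d B : ℕ

  module _ {a} {A : Set a} where

    ∈-vecs⁺ : ∀ {xs : List A} {n} {v : Vec A n} → VecAll.All (_∈ xs) v → v ∈ vecs xs n
    ∈-vecs⁺ []           = here refl
    ∈-vecs⁺ (x∈xs ∷ all) = ∈-cartesianProductWith⁺ _∷_ x∈xs (∈-vecs⁺ all)

    vecs-unique : ∀ {xs : List A} n → Unique xs → Unique (vecs xs n)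
    vecs-unique zero    _ = [] ∷ []
    vecs-unique (suc n) u =
      Unique.cartesianProductWith⁺ _∷_ Vecₚ.∷-injective u (vecs-unique n u)

  -- The range over which `ZW` and `𝔽ˢ` sum their labels, with B in the role of λ₁.
  box : (B L : ℕ) → List (Vec ℕ L)
  box B L = vecs (upTo (suc B)) L

  box-unique : ∀ B L → Unique (box B L)
  box-unique B L = vecs-unique L (Unique.upTo⁺ (suc B))

  -- The bound is put on the sum, which dominates every entry, because sums are what `_⊒_` controls.
  ∈-box : (v : Vec ℕ L) → sum v ≤ B → v ∈ box B L
  ∈-box v Σv≤B = ∈-vecs⁺ (VecAll.map (λ x≤ → ∈-upTo⁺ (s≤s (≤-trans x≤ Σv≤B))) (entries≤sum v))
    where
    entries≤sum : ∀ {L} (v : Vec ℕ L) → VecAll.All (_≤ sum v) v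
    entries≤sum []      = []
    entries≤sum (x ∷ v) = m≤m+n x (sum v) ∷ VecAll.map (m≤n⇒m≤o+n x) (entries≤sum v)

  -- Domination of all tail sums: for multiplicity vectors of conjugate
  -- partitions this is inclusion of Young diagrams.
  infix 4 _⊒_ _⊒?_
  _⊒_ : Vec ℕ L → Vec ℕ L → Set
  []       ⊒ []       = ⊤
  (x ∷ xs) ⊒ (y ∷ ys) = sum (y ∷ ys) ≤ sum (x ∷ xs) × xs ⊒ ys

  _⊒?_ : (x y : Vec ℕ L) → Dec (x ⊒ y)
  []       ⊒? []       = yes tt
  (x ∷ xs) ⊒? (y ∷ ys) = (sum (y ∷ ys) ≤? sum (x ∷ xs)) ×-dec (xs ⊒? ys)

  ⊒-refl : (x : Vec ℕ L) → x ⊒ x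
  ⊒-refl []       = tt
  ⊒-refl (x ∷ xs) = ≤-refl , ⊒-refl xs

  ⊒-trans : (x y z : Vec ℕ L) → x ⊒ y → y ⊒ z → x ⊒ z
  ⊒-trans []       []       []       _       _         = tt
  ⊒-trans (x ∷ xs) (y ∷ ys) (z ∷ zs) (p , q) (p′ , q′) = ≤-trans p′ p , ⊒-trans xs ys zs q q′

  ⊒⇒sum≤ : (x y : Vec ℕ L) → x ⊒ y → sum y ≤ sum x
  ⊒⇒sum≤ []       []       _       = z≤n
  ⊒⇒sum≤ (x ∷ xs) (y ∷ ys) (p , _) = p

  -- Appends d empty columns, as happens to a multiplicity vector when the grid is widened.
  pad : ∀ d → Vec ℕ L → Vec ℕ (L + d)
  pad d x = x ++ replicate d 0

  sum-pad : ∀ d (x : Vec ℕ L) → sum (pad d x) ≡ sum x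
  sum-pad zero    []       = refl
  sum-pad (suc d) []       = sum-pad d []
  sum-pad d       (x ∷ xs) = cong (x +_) (sum-pad d xs)

  pad-injective : ∀ d (x y : Vec ℕ L) → pad d x ≡ pad d y → x ≡ y
  pad-injective d x y = Vecₚ.++-injectiveˡ x y

  -- Past the first L entries the tail sums on the left are 0, which forces z to vanish; removing
  -- zeros then changes no tail sum.
  ⊒-pad : ∀ d (x y : Vec ℕ L) (z : Vec ℕ d) → pad d x ⊒ (y ++ z) → z ≡ replicate d 0 × x ⊒ y
  ⊒-pad zero [] [] []          _ = refl , tt
  ⊒-pad (suc d) [] [] (z ∷ zs) (z+Σ≤ , p)
    with zs≡0 , _ ← ⊒-pad d [] [] zs p =
    cong₂ _∷_ (n≤0⇒n≡0 (≤-trans (m≤m+n z (sum zs)) (≤-trans z+Σ≤ (≤-reflexive (sum-pad d []))))) zs≡0 , tt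
  ⊒-pad d (x ∷ xs) (y ∷ ys) z (Σ≤ , p)
    with refl , q ← ⊒-pad d xs ys z p =
    refl , ≡.subst₂ _≤_ (sum-pad d (y ∷ ys)) (sum-pad d (x ∷ xs)) Σ≤ , q

  -- Partitions and their multiplicity vectors

  ≡-parts : ∀ {la mu} → Partition.parts la ≡ Partition.parts mu → la ≡ mu
  ≡-parts {mkPartition _ d p} {mkPartition _ d′ p′} refl =
    cong₂ (mkPartition _) (Linked.irrelevant ≤-irrelevant d d′) (All.irrelevant <-irrelevant p p′)

  ∅ : Partition
  ∅ = mkPartition [] [] []

  -- Puts the new first part x + λ₁ in front, so that x is prepended to the multiplicity vector.
  -- Growing ∅ by 0 has to return ∅, as parts are positive.
  grow : ℕ → Partition → Partition
  grow x       (mkPartition (p ∷ ps) dec (0<p ∷ pos)) =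
    mkPartition (x + p ∷ p ∷ ps) (m≤n+m p x ∷ dec) (≤-trans 0<p (m≤n+m p x) ∷ 0<p ∷ pos)
  grow zero    (mkPartition [] _ _) = ∅
  grow (suc x) (mkPartition [] _ _) = mkPartition (suc x ∷ []) [-] (z<s ∷ [])

  part-grow-zero : ∀ x la → part (grow x la) 0 ≡ x + part la 0
  part-grow-zero zero    (mkPartition [] _ _)            = refl
  part-grow-zero (suc x) (mkPartition [] _ _)            = ≡.sym (+-identityʳ (suc x))
  part-grow-zero x       (mkPartition (_ ∷ _) _ (_ ∷ _)) = refl

  part-grow-suc : ∀ x la i → part (grow x la) (suc i) ≡ part la i
  part-grow-suc zero    (mkPartition [] _ _)            i = refl
  part-grow-suc (suc x) (mkPartition [] _ _)            i = refl
  part-grow-suc x       (mkPartition (_ ∷ _) _ (_ ∷ _)) i = refl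

  len-grow : ∀ x la → len (grow x la) ≤ suc (len la)
  len-grow zero    (mkPartition [] _ _)            = z≤n
  len-grow (suc x) (mkPartition [] _ _)            = ≤-refl
  len-grow x       (mkPartition (_ ∷ _) _ (_ ∷ _)) = ≤-refl

  -- The inequality of first parts excludes the one bad case of equal lengths: both partitions
  -- empty, x = 0 and y > 0, where only the smaller side would gain a part.
  len-grow-mono : ∀ x y la mu → y + part mu 0 ≤ x + part la 0 → len mu ≤ len la →
                  len (grow y mu) ≤ len (grow x la)
  len-grow-mono x       zero    _ (mkPartition [] _ _)  _ _ = z≤n
  len-grow-mono (suc x) (suc y) (mkPartition [] _ _) (mkPartition [] _ _) _ _ = ≤-refl
  len-grow-mono x       (suc y) (mkPartition (_ ∷ _) _ (_ ∷ _)) (mkPartition [] _ _) _ _ = s≤s z≤n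
  len-grow-mono x       y (mkPartition (_ ∷ _) _ (_ ∷ _)) (mkPartition (_ ∷ _) _ (_ ∷ _)) _ l = s≤s l

  mults : ∀ L → Partition → Vec ℕ L
  mults L la = tabulate (λ c → mult′ la (toℕ c))

  -- Inverse to `mults L` on partitions with at most L parts: the parts are the tail sums of the
  -- vector.
  toPartition : Vec ℕ L → Partition
  toPartition []      = ∅
  toPartition (x ∷ v) = grow x (toPartition v)

  part-toPartition : (v : Vec ℕ L) → part (toPartition v) 0 ≡ sum v
  part-toPartition []      = refl
  part-toPartition (x ∷ v) = ≡.trans (part-grow-zero x (toPartition v)) (cong (x +_) (part-toPartition v))

  len-toPartition : (v : Vec ℕ L) → len (toPartition v) ≤ L
  len-toPartition []      = z≤n
  len-toPartition (x ∷ v) = ≤-trans (len-grow x (toPartition v)) (s≤s (len-toPartition v))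

  mults-toPartition : (v : Vec ℕ L) → mults L (toPartition v) ≡ v
  mults-toPartition []      = refl
  mults-toPartition (x ∷ v) = cong₂ _∷_
    (≡.trans (cong₂ _∸_ (part-grow-zero x la) (part-grow-suc x la 0)) (m+n∸n≡m x (part la 0)))
    (≡.trans (Vecₚ.tabulate-cong (λ c → cong₂ _∸_ (part-grow-suc x la (toℕ c)) (part-grow-suc x la (suc (toℕ c)))))
             (mults-toPartition v))
    where la = toPartition v

  toPartition-injective : (v w : Vec ℕ L) → toPartition v ≡ toPartition w → v ≡ w
  toPartition-injective {L} v w eq =
    ≡.trans (≡.sym (mults-toPartition v)) (≡.trans (cong (mults L) eq) (mults-toPartition w))

  toPartition-mults : ∀ L la → len la ≤ L → toPartition (mults L la) ≡ la
  toPartition-mults zero    (mkPartition [] [] []) _ = refl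
  toPartition-mults (suc L) (mkPartition [] [] []) _ = cong (grow 0) (toPartition-mults L ∅ z≤n)
  toPartition-mults (suc L) (mkPartition (suc p ∷ []) dec (_ ∷ pos)) _ = ≡.trans
    (cong (grow (suc p)) (toPartition-mults L ∅ z≤n)) (≡-parts refl)
  toPartition-mults (suc L) (mkPartition (p ∷ p′ ∷ ps) (p≥p′ ∷ dec) (_ ∷ pos@(_ ∷ _))) (s≤s l) = ≡.trans
    (cong (grow (p ∸ p′)) (toPartition-mults L (mkPartition (p′ ∷ ps) dec pos) l))
    (≡-parts (cong (λ x → x ∷ p′ ∷ ps) (m∸n+n≡m p≥p′)))

  sum-mults : ∀ L la → len la ≤ L → sum (mults L la) ≡ part la 0
  sum-mults L la l = ≡.trans (≡.sym (part-toPartition (mults L la))) (cong (λ nu → part nu 0) (toPartition-mults L la l))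

  -- From index L on the minuend λ_{i+1} of `mult′` is 0, and truncated subtraction from 0 gives 0.
  mults-pad : ∀ L d la → len la ≤ L → mults (L + d) la ≡ pad d (mults L la)
  mults-pad L d la l = go L (mult′ la) (λ i L≤i → ≡.trans
    (cong (_∸ part la (suc i)) (nth-beyond (Partition.parts la) i (≤-trans l L≤i))) (0∸n≡0 (part la (suc i))))
    where
    nth-beyond : ∀ ps i → List.length ps ≤ i → nth ps i ≡ 0
    nth-beyond []       i       _       = refl
    nth-beyond (_ ∷ ps) (suc i) (s≤s l) = nth-beyond ps i l
    go : ∀ L (f : ℕ → ℕ) → (∀ i → L ≤ i → f i ≡ 0) →
         tabulate {n = L + d} (f ∘ toℕ) ≡ pad d (tabulate {n = L} (f ∘ toℕ))
    go zero    f f≡0 = ≡.trans (Vecₚ.tabulate-cong (λ c → f≡0 (toℕ c) z≤n)) (zeros d)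
      where
      zeros : ∀ d → tabulate {n = d} (λ _ → 0) ≡ replicate d 0
      zeros zero    = refl
      zeros (suc d) = cong (0 ∷_) (zeros d)
    go (suc L) f f≡0 = cong (f 0 ∷_) (go L (f ∘ suc) (λ i L≤i → f≡0 (suc i) (s≤s L≤i)))

  -- The tail sums compared by `_⊒_` are the parts themselves, so each component supplies the
  -- inequality of first parts that `len-grow-mono` asks for.
  ⊒⇒len≤ : (v w : Vec ℕ L) → v ⊒ w → len (toPartition w) ≤ len (toPartition v)
  ⊒⇒len≤ []       []       _       = z≤n
  ⊒⇒len≤ (x ∷ xs) (y ∷ ys) (Σ≤ , p) =
    len-grow-mono x y (toPartition xs) (toPartition ys)
      (≡.subst₂ (λ a b → y + a ≤ x + b) (≡.sym (part-toPartition ys)) (≡.sym (part-toPartition xs)) Σ≤)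
      (⊒⇒len≤ xs ys p)

open Diagrams

-- Finite sums and indicators

module Sums {c ℓ₁ ℓ₂} (K : Field c ℓ₁ ℓ₂) where

  open Field K
  open SpinQWhittaker K
  open CommutativeRing commutativeRing public
    using (*-commutativeMonoid; *-commutativeSemigroup; +-commutativeSemigroup)
  open import Relation.Binary.Reasoning.Setoid setoid
  open import Algebra.Properties.CommutativeSemigroup +-commutativeSemigroup
    using () renaming (interchange to +-interchange)

  𝟙-yes : ∀ {p} {P : Set p} (P? : Dec P) → P → 𝟙 P? ≈ 1#
  𝟙-yes (yes _) _ = refl
  𝟙-yes (no ¬p) p = ⊥-elim (¬p p)

  𝟙-no : ∀ {p} {P : Set p} (P? : Dec P) → ¬ P → 𝟙 P? ≈ 0#
  𝟙-no (yes p) ¬p = ⊥-elim (¬p p)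
  𝟙-no (no _)  _  = refl

  𝟙-cong : ∀ {p r} {P : Set p} {R : Set r} (P? : Dec P) (R? : Dec R) →
           (P → R) → (R → P) → 𝟙 P? ≈ 𝟙 R?
  𝟙-cong (yes p) R? f g = sym (𝟙-yes R? (f p))
  𝟙-cong (no ¬p) R? f g = sym (𝟙-no R? (¬p ∘ g))

  𝟙-× : ∀ {p r} {P : Set p} {R : Set r} (P? : Dec P) (R? : Dec R) →
        𝟙 (P? ×-dec R?) ≈ 𝟙 P? * 𝟙 R?
  𝟙-× (yes _) R? = sym (*-identityˡ _)
  𝟙-× (no _)  R? = sym (zeroˡ _)

  zeroˡ′ : ∀ {x y} → x ≈ 0# → x * y ≈ 0#
  zeroˡ′ x≈0 = trans (*-congʳ x≈0) (zeroˡ _)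

  zeroʳ′ : ∀ {x y} → y ≈ 0# → x * y ≈ 0#
  zeroʳ′ y≈0 = trans (*-congˡ y≈0) (zeroʳ _)

  module _ {a} {A : Set a} where

    ∑-cong-∈ : ∀ (xs : List A) {f g} → (∀ x → x ∈ xs → f x ≈ g x) → ∑ xs f ≈ ∑ xs g
    ∑-cong-∈ []       f≈g = refl
    ∑-cong-∈ (x ∷ xs) f≈g =
      +-cong (f≈g x (here ≡.refl)) (∑-cong-∈ xs (λ y y∈ → f≈g y (there y∈)))

    ∑-cong : ∀ (xs : List A) {f g} → (∀ x → f x ≈ g x) → ∑ xs f ≈ ∑ xs g
    ∑-cong xs f≈g = ∑-cong-∈ xs (λ x _ → f≈g x)

    ∑-zero : ∀ (xs : List A) {f} → (∀ x → x ∈ xs → f x ≈ 0#) → ∑ xs f ≈ 0#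
    ∑-zero []       f≈0 = refl
    ∑-zero (x ∷ xs) f≈0 = trans
      (+-cong (f≈0 x (here ≡.refl)) (∑-zero xs (λ y y∈ → f≈0 y (there y∈)))) (+-identityˡ 0#)

    ∑-distrib-+ : ∀ (xs : List A) f g → ∑ xs (λ x → f x + g x) ≈ ∑ xs f + ∑ xs g
    ∑-distrib-+ []       f g = sym (+-identityˡ 0#)
    ∑-distrib-+ (x ∷ xs) f g =
      trans (+-congˡ (∑-distrib-+ xs f g)) (+-interchange _ _ _ _)

    *-distribˡ-∑ : ∀ (xs : List A) x f → x * ∑ xs f ≈ ∑ xs (λ y → x * f y)
    *-distribˡ-∑ []       x f = zeroʳ x
    *-distribˡ-∑ (y ∷ ys) x f = trans (distribˡ x _ _) (+-congˡ (*-distribˡ-∑ ys x f))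

    *-distribʳ-∑ : ∀ (xs : List A) x f → ∑ xs f * x ≈ ∑ xs (λ y → f y * x)
    *-distribʳ-∑ xs x f =
      trans (*-comm _ x) (trans (*-distribˡ-∑ xs x f) (∑-cong xs (λ y → *-comm x _)))

    ∑-++ : ∀ (xs ys : List A) f → ∑ (xs List.++ ys) f ≈ ∑ xs f + ∑ ys f
    ∑-++ []       ys f = sym (+-identityˡ _)
    ∑-++ (x ∷ xs) ys f = trans (+-congˡ (∑-++ xs ys f)) (sym (+-assoc _ _ _))

    ∑-only : ∀ {xs : List A} {x} f → Unique xs → x ∈ xs →
             (∀ y → y ≢ x → f y ≈ 0#) → ∑ xs f ≈ f x
    ∑-only {_ ∷ xs} f (x∉ ∷ _) (here ≡.refl) f≈0 = trans
      (+-congˡ (∑-zero xs (λ y y∈ → f≈0 y (λ y≡x → All.lookup x∉ y∈ (≡.sym y≡x))))) (+-identityʳ _)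
    ∑-only {y ∷ xs} f (y∉ ∷ u) (there x∈) f≈0 = trans
      (+-cong (f≈0 y (All.lookup y∉ x∈)) (∑-only f u x∈ f≈0)) (+-identityˡ _)

  module _ {a b} {A : Set a} {B : Set b} where

    ∑-map : ∀ (e : A → B) (xs : List A) f → ∑ (List.map e xs) f ≡ ∑ xs (f ∘ e)
    ∑-map e []       f = ≡.refl
    ∑-map e (x ∷ xs) f = ≡.cong (f (e x) +_) (∑-map e xs f)

    ∑-swap : ∀ (xs : List A) (ys : List B) (f : A → B → Carrier) →
             ∑ xs (λ x → ∑ ys (λ y → f x y)) ≈ ∑ ys (λ y → ∑ xs (λ x → f x y))
    ∑-swap []       ys f = sym (∑-zero ys (λ _ _ → refl))
    ∑-swap (x ∷ xs) ys f =
      trans (+-congˡ (∑-swap xs ys f)) (sym (∑-distrib-+ ys (f x) (λ y → ∑ xs (λ x → f x y))))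

    ∑-*-∑ : ∀ (xs : List A) (ys : List B) f g →
            ∑ xs (λ x → ∑ ys (λ y → f x * g y)) ≈ ∑ xs f * ∑ ys g
    ∑-*-∑ xs ys f g = trans
      (∑-cong xs (λ x → sym (*-distribˡ-∑ ys (f x) g))) (sym (*-distribʳ-∑ xs (∑ ys g) f))

  module _ {a} {A : Set a} where

    ∑-vecs : ∀ (xs : List A) n f →
             ∑ (vecs xs (suc n)) f ≈ ∑ xs (λ x → ∑ (vecs xs n) (λ v → f (x ∷ v)))
    ∑-vecs xs n f = go xs
      where
      -- The list of heads varies in the recursion while the list of tails stays fixed.
      go : ∀ ys → ∑ (cartesianProductWith _∷_ ys (vecs xs n)) f ≈
                  ∑ ys (λ x → ∑ (vecs xs n) (λ v → f (x ∷ v)))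
      go []       = refl
      go (y ∷ ys) = trans (∑-++ (List.map (Vec._∷_ y) (vecs xs n)) _ f)
                          (+-cong (reflexive (∑-map (Vec._∷_ y) (vecs xs n) f)) (go ys))

  -- Both sides equal the double sum of 𝟙 (x ≟ y) f(y).
  ∑-support : ∀ {a} {A : Set a} (_≟_ : DecidableEquality A) {xs ys : List A} (f : A → Carrier) →
              Unique xs → Unique ys →
              (∀ x → x ∉ xs → f x ≈ 0#) → (∀ y → y ∉ ys → f y ≈ 0#) →
              ∑ xs f ≈ ∑ ys f
  ∑-support _≟_ {xs} {ys} f uxs uys xs-supp ys-supp = begin
    ∑ xs f                                       ≈⟨ ∑-cong xs (λ x → sym (select uys ys-supp x)) ⟩
    ∑ xs (λ x → ∑ ys (λ y → 𝟙 (x ≟ y) * f y))    ≈⟨ ∑-swap xs ys _ ⟩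
    ∑ ys (λ y → ∑ xs (λ x → 𝟙 (x ≟ y) * f y))    ≈⟨ ∑-cong ys (λ y → ∑-cong xs (λ x → flip y x)) ⟩
    ∑ ys (λ y → ∑ xs (λ x → 𝟙 (y ≟ x) * f x))    ≈⟨ ∑-cong ys (select uxs xs-supp) ⟩
    ∑ ys f                                       ∎
    where
    open DecMembership _≟_ using (_∈?_)
    flip : ∀ y x → 𝟙 (x ≟ y) * f y ≈ 𝟙 (y ≟ x) * f x
    flip y x with x ≟ y
    ... | yes ≡.refl = *-congʳ (sym (𝟙-yes (y ≟ x) ≡.refl))
    ... | no x≢y     = trans (zeroˡ _) (sym (zeroˡ′ (𝟙-no (y ≟ x) (x≢y ∘ ≡.sym))))
    select : ∀ {zs} → Unique zs → (∀ y → y ∉ zs → f y ≈ 0#) → ∀ x →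
             ∑ zs (λ y → 𝟙 (x ≟ y) * f y) ≈ f x
    select {zs} u supp x with x ∈? zs
    ... | yes x∈ = trans
      (∑-only _ u x∈ (λ y y≢x → zeroˡ′ (𝟙-no (x ≟ y) (y≢x ∘ ≡.sym))))
      (trans (*-congʳ (𝟙-yes (x ≟ x) ≡.refl)) (*-identityˡ _))
    ... | no x∉ = trans (∑-zero zs λ y y∈ → zeroˡ′ (𝟙-no (x ≟ y) λ { ≡.refl → x∉ y∈ }))
                        (sym (supp x x∉))

  ∑-𝟙 : ∀ {a} {A : Set a} (_≟_ : DecidableEquality A) {xs : List A} {x} (f : A → Carrier) →
        Unique xs → x ∈ xs → ∑ xs (λ y → 𝟙 (y ≟ x) * f y) ≈ f x
  ∑-𝟙 _≟_ {x = x} f u x∈ = trans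
    (∑-only _ u x∈ (λ y y≢x → zeroˡ′ (𝟙-no (y ≟ x) y≢x)))
    (trans (*-congʳ (𝟙-yes (x ≟ x) ≡.refl)) (*-identityˡ _))

-- Rows and grids of vertices

module Lattice {c ℓ₁ ℓ₂} (K : Field c ℓ₁ ℓ₂) where

  open Field K
  open SpinQWhittaker K
  open Sums K
  open import Relation.Binary.Reasoning.Setoid setoid
  open import Algebra.Properties.CommutativeSemigroup *-commutativeSemigroup
    using () renaming (x∙yz≈y∙xz to x*yz≈y*xz)
  open MonoidSolver *-commutativeMonoid using (solve; _⊜_; _⊕_)

  private variable
    L n : ℕ

  infix 4 _≟ᵛ_
  _≟ᵛ_ : (x y : Vec ℕ L) → Dec (x ≡ y)
  _≟ᵛ_ = Vecₚ.≡-dec ℕₚ._≟_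

  -- Vertex weights w c i j k l, where c is the column.
  Weight : Set c
  Weight = ℕ → (i j k l : ℕ) → Carrier

  -- These two properties carry the lattice argument: the first determines the horizontal labels,
  -- the second lets empty columns be appended.
  Conserving Vacuous : Weight → Set ℓ₁
  Conserving w = ∀ c {i j k l} → i ℕ.+ j ≢ k ℕ.+ l → w c i j k l ≈ 0#
  Vacuous w    = ∀ c → w c 0 0 0 0 ≈ 1#

  -- The weight of a row with top x and bottom y. By conservation the label
  -- of a horizontal edge is the difference of the sums of x and y to the
  -- right of it.
  columns : Weight → Vec ℕ L → Vec ℕ L → Carrier
  columns w []       []       = 1#
  columns w (x ∷ xs) (y ∷ ys) =
    w 0 y (sum (x ∷ xs) ∸ sum (y ∷ ys)) x (sum xs ∸ sum ys) * columns (w ∘ suc) xs ys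

  -- Consider the rightmost tail sum at which domination fails. The label to the right of that
  -- column is a genuine difference, while the one to its left is truncated to 0. Conservation would
  -- then make the two tail sums equal.
  columns-support : ∀ {w} → Conserving w → (x y : Vec ℕ L) → ¬ x ⊒ y → columns w x y ≈ 0#
  columns-support cons []       []       ¬⊒ = ⊥-elim (¬⊒ tt)
  columns-support cons (x ∷ xs) (y ∷ ys) ¬⊒ with xs ⊒? ys
  ... | no  ¬q = zeroʳ′ (columns-support (λ c → cons (suc c)) xs ys ¬q)
  ... | yes q  = zeroˡ′ (cons 0 λ eq → ≰ (ℕₚ.≤-reflexive (sums-agree eq)))
    where
    ≰ : ¬ sum (y ∷ ys) ≤ sum (x ∷ xs)
    ≰ p = ¬⊒ (p , q)
    sums-agree : y ℕ.+ (sum (x ∷ xs) ∸ sum (y ∷ ys)) ≡ x ℕ.+ (sum xs ∸ sum ys) →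
                 sum (y ∷ ys) ≡ sum (x ∷ xs)
    sums-agree eq = ≡.trans (≡.cong (ℕ._+ sum ys) y≡)
      (≡.trans (ℕₚ.+-assoc x _ _) (≡.cong (x ℕ.+_) (ℕₚ.m∸n+n≡m (⊒⇒sum≤ xs ys q))))
      where
      y≡ : y ≡ x ℕ.+ (sum xs ∸ sum ys)
      y≡ = ≡.trans (≡.sym (ℕₚ.+-identityʳ y))
             (≡.trans (≡.cong (y ℕ.+_) (≡.sym (ℕₚ.m≤n⇒m∸n≡0 (ℕₚ.≰⇒≥ ≰)))) eq)

  columns-cong : ∀ {w w′} → (∀ c i j k l → w c i j k l ≈ w′ c i j k l) →
                 (x y : Vec ℕ L) → columns w x y ≈ columns w′ x y
  columns-cong w≈w′ []       []       = refl
  columns-cong w≈w′ (x ∷ xs) (y ∷ ys) =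
    *-cong (w≈w′ 0 _ _ _ _) (columns-cong (λ c → w≈w′ (suc c)) xs ys)

  columns-pad : ∀ {w} d → Vacuous w → (x y : Vec ℕ L) →
                columns w (pad d x) (pad d y) ≈ columns w x y
  columns-pad zero    vac [] [] = refl
  columns-pad {w = w} (suc d) vac [] [] = trans
    -- Both horizontal labels reduce to `z ∸ z`, hence to 0.
    (*-cong (trans (reflexive (≡.cong₂ (λ i j → w 0 0 i 0 j) (ℕₚ.n∸n≡0 z) (ℕₚ.n∸n≡0 z))) (vac 0))
            (columns-pad d (λ c → vac (suc c)) [] []))
    (*-identityˡ 1#)
    where z = sum (replicate d 0)
  columns-pad {w = w} d vac (x ∷ xs) (y ∷ ys) = *-cong
    (reflexive (≡.cong₂ (λ i j → w 0 y i x j)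
      (≡.cong₂ _∸_ (sum-pad d (x ∷ xs)) (sum-pad d (y ∷ ys)))
      (≡.cong₂ _∸_ (sum-pad d xs) (sum-pad d ys))))
    (columns-pad d (λ c → vac (suc c)) xs ys)

  -- The left label a is a parameter, so that peeling off a column leaves a sum of the same shape
  -- whose left label is the next one.
  rowSum : ℕ → Weight → Vec ℕ L → Vec ℕ L → ℕ → Carrier
  rowSum {L} B w x y a = ∑ (box B L) λ g →
    𝟙 (lookup (a ∷ g) (fromℕ L) ℕₚ.≟ 0) * product {L} λ c →
      w (toℕ c) (lookup y c) (lookup (a ∷ g) (inject₁ c)) (lookup x c) (lookup g c)

  -- Induction on the columns: the remaining columns force the label after the first column to be
  -- the difference of their sums, and conservation at the first vertex then forces a. The bound on
  -- sum x keeps the forced label within the range of summation.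
  rowSum≈columns : ∀ {B w} → Conserving w → (x y : Vec ℕ L) (a : ℕ) → sum x ≤ B →
                   rowSum B w x y a ≈ 𝟙 (sum y ℕ.+ a ℕₚ.≟ sum x) * columns w x y
  rowSum≈columns cons [] [] a _ = +-identityʳ _
  rowSum≈columns {suc L} {B} {w} cons (x ∷ xs) (y ∷ ys) a Σ≤B = begin
    rowSum B w (x ∷ xs) (y ∷ ys) a
      ≈⟨ ∑-vecs labels L _ ⟩
    ∑ labels (λ b → ∑ (box B L) λ g → 𝟙 (lookup (b ∷ g) (fromℕ L) ℕₚ.≟ 0) * (w 0 y a x b * rest b g))
      ≈⟨ ∑-cong labels (λ b → ∑-cong (box B L) (λ g → x*yz≈y*xz _ _ _)) ⟩
    ∑ labels (λ b → ∑ (box B L) λ g → w 0 y a x b * (𝟙 (lookup (b ∷ g) (fromℕ L) ℕₚ.≟ 0) * rest b g))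
      ≈⟨ ∑-cong labels (λ b → sym (*-distribˡ-∑ (box B L) _ _)) ⟩
    ∑ labels (λ b → w 0 y a x b * rowSum B (w ∘ suc) xs ys b)
      ≈⟨ ∑-cong labels (λ b → *-congˡ (rowSum≈columns (λ c → cons (suc c)) xs ys b Σxs≤B)) ⟩
    ∑ labels (λ b → w 0 y a x b * (𝟙 (sum ys ℕ.+ b ℕₚ.≟ sum xs) * columns (w ∘ suc) xs ys))
      ≈⟨ collapse (sum ys ℕₚ.≤? sum xs) ⟩
    𝟙 (sum (y ∷ ys) ℕ.+ a ℕₚ.≟ sum (x ∷ xs)) * columns w (x ∷ xs) (y ∷ ys) ∎
    where
    labels = upTo (suc B)
    b* = sum xs ∸ sum ys
    Σxs≤B : sum xs ≤ B
    Σxs≤B = ℕₚ.≤-trans (ℕₚ.m≤n+m (sum xs) x) Σ≤B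
    rest : ℕ → Vec ℕ L → Carrier
    rest b g = product {L} λ c →
      w (suc (toℕ c)) (lookup ys c) (lookup (b ∷ g) (inject₁ c)) (lookup xs c) (lookup g c)
    rows≡ : ∀ {a} → sum ys ≤ sum xs → y ℕ.+ a ≡ x ℕ.+ b* → sum (y ∷ ys) ℕ.+ a ≡ sum (x ∷ xs)
    rows≡ {a} p eq = ≡.trans (≡.trans (ℕₚ.+-assoc y (sum ys) a) (≡.trans (≡.cong (y ℕ.+_) (ℕₚ.+-comm (sum ys) a))
        (≡.sym (ℕₚ.+-assoc y a (sum ys)))))
      (≡.trans (≡.cong (ℕ._+ sum ys) eq)
        (≡.trans (ℕₚ.+-assoc x b* (sum ys)) (≡.cong (x ℕ.+_) (ℕₚ.m∸n+n≡m p))))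
    collapse : Dec (sum ys ≤ sum xs) →
      ∑ labels (λ b → w 0 y a x b * (𝟙 (sum ys ℕ.+ b ℕₚ.≟ sum xs) * columns (w ∘ suc) xs ys)) ≈
      𝟙 (sum (y ∷ ys) ℕ.+ a ℕₚ.≟ sum (x ∷ xs)) * columns w (x ∷ xs) (y ∷ ys)
    -- The remaining columns violate domination, so their weight is 0 and both sides vanish.
    collapse (no ≰) = trans
      (∑-zero labels (λ b _ → zeroʳ′ (zeroʳ′ cols≈0)))
      (sym (zeroʳ′ (zeroʳ′ cols≈0)))
      where
      cols≈0 : columns (w ∘ suc) xs ys ≈ 0#
      cols≈0 = columns-support (λ c → cons (suc c)) xs ys (≰ ∘ ⊒⇒sum≤ xs ys)
    collapse (yes p) = begin
      ∑ labels (λ b → w 0 y a x b * (𝟙 (sum ys ℕ.+ b ℕₚ.≟ sum xs) * columns (w ∘ suc) xs ys))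
        ≈⟨ ∑-only _ (Unique.upTo⁺ (suc B))
             (∈-upTo⁺ (s≤s (ℕₚ.≤-trans (ℕₚ.m∸n≤m (sum xs) (sum ys)) Σxs≤B)))
             (λ b b≢ → zeroʳ′ (zeroˡ′ (𝟙-no (_ ℕₚ.≟ _) (λ eq → b≢
               (≡.trans (≡.sym (ℕₚ.m+n∸m≡n (sum ys) b)) (≡.cong (_∸ sum ys) eq)))))) ⟩
      w 0 y a x b* * (𝟙 (sum ys ℕ.+ b* ℕₚ.≟ sum xs) * columns (w ∘ suc) xs ys)
        ≈⟨ *-congˡ (trans (*-congʳ (𝟙-yes (_ ℕₚ.≟ _) (ℕₚ.m+[n∸m]≡n p))) (*-identityˡ _)) ⟩
      w 0 y a x b* * columns (w ∘ suc) xs ys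
        ≈⟨ left-label (sum (y ∷ ys) ℕ.+ a ℕₚ.≟ sum (x ∷ xs)) ⟩
      𝟙 (sum (y ∷ ys) ℕ.+ a ℕₚ.≟ sum (x ∷ xs)) * columns w (x ∷ xs) (y ∷ ys) ∎
      where
      left-label : (D : Dec (sum (y ∷ ys) ℕ.+ a ≡ sum (x ∷ xs))) →
        w 0 y a x b* * columns (w ∘ suc) xs ys ≈ 𝟙 D * columns w (x ∷ xs) (y ∷ ys)
      left-label (yes eq) = trans
        (*-congʳ (reflexive (≡.cong (λ i → w 0 y i x b*)
          (≡.trans (≡.sym (ℕₚ.m+n∸m≡n (sum (y ∷ ys)) a)) (≡.cong (_∸ sum (y ∷ ys)) eq)))))
        (sym (*-identityˡ _))
      -- A wrong left label breaks conservation at the first vertex.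
      left-label (no ≢) = trans (zeroˡ′ (cons 0 (≢ ∘ rows≡ p))) (sym (zeroˡ _))

  -- The top row x is an argument, not a summation variable under an indicator, so that removing the
  -- first row leaves a `grid` that starts from the next one.
  grid : ℕ → (Fin n → Weight) → Vec ℕ L → Vec ℕ L → Vec ℕ n → Carrier
  grid {n} {L} B w x y a =
    ∑ (vecs (box B L) n) λ v → ∑ (vecs (box B (suc L)) n) λ h →
      (𝟙 (lookup (x ∷ v) (fromℕ n) ≟ᵛ y) *
       (𝟙 (Vec.map (λ g → lookup g Fin.zero) h ≟ᵛ a) *
        𝟙 (Vec.map (λ g → lookup g (fromℕ L)) h ≟ᵛ replicate n 0))) *
      product {n} λ r → product {L} λ c →
        w r (toℕ c) (bottom (x ∷ v) h r c) (left (x ∷ v) h r c) (top (x ∷ v) h r c) (right (x ∷ v) h r c)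

  grid-zero : ∀ B (w : Fin 0 → Weight) (x y : Vec ℕ L) → grid B w x y [] ≈ 𝟙 (x ≟ᵛ y)
  grid-zero B w x y = trans (+-identityʳ _) (trans (+-identityʳ _) (trans (*-identityʳ _)
    (trans (*-congˡ (*-identityˡ 1#)) (*-identityʳ _))))

  -- The first row and the remaining ones share only the vertical labels z between them, so weights
  -- and boundary conditions factor for fixed z. The indicator of the left label picks out a, which
  -- must lie in the range of summation.
  grid-suc : ∀ B (w : Fin (suc n) → Weight) (x y : Vec ℕ L) {a} (as : Vec ℕ n) → a ∈ upTo (suc B) →
             grid B w x y (a ∷ as) ≈
             ∑ (box B L) λ z → rowSum B (w Fin.zero) x z a * grid B (w ∘ Fin.suc) z y as
  grid-suc {n} {L} B w x y {a} as a∈ = begin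
    grid B w x y (a ∷ as)
      ≈⟨ ∑-vecs V n _ ⟩
    ∑ V (λ z → ∑ (vecs V n) λ v → ∑ (vecs G (suc n)) λ h → _)
      ≈⟨ ∑-cong V (λ z → ∑-cong (vecs V n) λ v → ∑-vecs G n _) ⟩
    ∑ V (λ z → ∑ (vecs V n) λ v → ∑ G λ g → ∑ (vecs G n) λ h → _)
      -- The first row involves z and g only, so g is moved outside the lower vertical labels v.
      ≈⟨ ∑-cong V (λ z → ∑-swap (vecs V n) G _) ⟩
    ∑ V (λ z → ∑ G λ g → ∑ (vecs V n) λ v → ∑ (vecs G n) λ h → _)
      ≈⟨ ∑-cong V (λ z → ∑-cong G λ g → ∑-cong (vecs V n) λ v → ∑-cong (vecs G n) λ h → factor z v g h) ⟩
    ∑ V (λ z → ∑ G λ g → ∑ (vecs V n) λ v → ∑ (vecs G n) λ h → row z g * rest z v h)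
      ≈⟨ ∑-cong V (λ z → ∑-cong G λ g → ∑-cong (vecs V n) λ v → sym (*-distribˡ-∑ (vecs G n) _ _)) ⟩
    ∑ V (λ z → ∑ G λ g → ∑ (vecs V n) λ v → row z g * ∑ (vecs G n) (rest z v))
      ≈⟨ ∑-cong V (λ z → ∑-*-∑ G (vecs V n) (row z) (λ v → ∑ (vecs G n) (rest z v))) ⟩
    ∑ V (λ z → ∑ G (row z) * grid B (w ∘ Fin.suc) z y as)
      ≈⟨ ∑-cong V (λ z → *-congʳ (first-label z)) ⟩
    ∑ V (λ z → rowSum B (w Fin.zero) x z a * grid B (w ∘ Fin.suc) z y as) ∎
    where
    V = box B L
    G = box B (suc L)
    rowProduct : Vec ℕ L → Vec ℕ (suc L) → Carrier
    rowProduct z g = product {L} λ c →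
      w Fin.zero (toℕ c) (lookup z c) (lookup g (inject₁ c)) (lookup x c) (lookup g (Fin.suc c))
    row : Vec ℕ L → Vec ℕ (suc L) → Carrier
    row z g = 𝟙 (lookup g Fin.zero ℕₚ.≟ a) * (𝟙 (lookup g (fromℕ L) ℕₚ.≟ 0) * rowProduct z g)
    rest : Vec ℕ L → Vec (Vec ℕ L) n → Vec (Vec ℕ (suc L)) n → Carrier
    rest z v h =
      (𝟙 (lookup (z ∷ v) (fromℕ n) ≟ᵛ y) *
       (𝟙 (Vec.map (λ g → lookup g Fin.zero) h ≟ᵛ as) *
        𝟙 (Vec.map (λ g → lookup g (fromℕ L)) h ≟ᵛ replicate n 0))) *
      product {n} λ r → product {L} λ c →
        w (Fin.suc r) (toℕ c) (bottom (z ∷ v) h r c) (left (z ∷ v) h r c)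
          (top (z ∷ v) h r c) (right (z ∷ v) h r c)
    𝟙-∷ : ∀ {n} b (bs : Vec ℕ n) b′ bs′ → 𝟙 ((b ∷ bs) ≟ᵛ (b′ ∷ bs′)) ≈ 𝟙 (b ℕₚ.≟ b′) * 𝟙 (bs ≟ᵛ bs′)
    𝟙-∷ b bs b′ bs′ = 𝟙-× (b ℕₚ.≟ b′) (bs ≟ᵛ bs′)
    factor : ∀ z v g h →
      (𝟙 (lookup (z ∷ v) (fromℕ n) ≟ᵛ y) *
       (𝟙 (Vec.map (λ g → lookup g Fin.zero) (g ∷ h) ≟ᵛ (a ∷ as)) *
        𝟙 (Vec.map (λ g → lookup g (fromℕ L)) (g ∷ h) ≟ᵛ replicate (suc n) 0))) *
      (rowProduct z g * product {n} λ r → product {L} λ c →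
        w (Fin.suc r) (toℕ c) (bottom (z ∷ v) h r c) (left (z ∷ v) h r c)
          (top (z ∷ v) h r c) (right (z ∷ v) h r c)) ≈
      row z g * rest z v h
    factor z v g h = trans
      (*-congʳ (*-congˡ (*-cong (𝟙-∷ (lookup g Fin.zero) (Vec.map (λ g → lookup g Fin.zero) h) a as)
                                (𝟙-∷ (lookup g (fromℕ L)) (Vec.map (λ g → lookup g (fromℕ L)) h) 0 (replicate n 0)))))
      (solve 7 (λ e p q r s t u → (e ⊕ ((p ⊕ q) ⊕ (r ⊕ s))) ⊕ (t ⊕ u) ⊜
                                   (p ⊕ (r ⊕ t)) ⊕ ((e ⊕ (q ⊕ s)) ⊕ u)) refl _ _ _ _ _ _ _)
    first-label : ∀ z → ∑ G (row z) ≈ rowSum B (w Fin.zero) x z a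
    first-label z = begin
      ∑ G (row z)
        ≈⟨ ∑-vecs (upTo (suc B)) L (row z) ⟩
      ∑ (upTo (suc B)) (λ b → ∑ (box B L) λ g → row z (b ∷ g))
        ≈⟨ ∑-cong (upTo (suc B)) (λ b → sym (*-distribˡ-∑ (box B L) _ _)) ⟩
      ∑ (upTo (suc B)) (λ b → 𝟙 (b ℕₚ.≟ a) * rowSum B (w Fin.zero) x z b)
        ≈⟨ ∑-𝟙 ℕₚ._≟_ _ (Unique.upTo⁺ (suc B)) a∈ ⟩
      rowSum B (w Fin.zero) x z a ∎

  -- φ is the boundary factor, a function of the left label of the row.
  record Row : Set (c Level.⊔ ℓ₁) where
    field
      φ          : ℕ → Carrier
      weight     : Weight
      conserving : Conserving weight
      vacuous    : Vacuous weight

  open Row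

  -- Products of transfer matrices

  step : Row → Vec ℕ L → Vec ℕ L → Carrier
  step R x y = φ R (sum x ∸ sum y) * columns (weight R) x y

  step-support : ∀ R (x y : Vec ℕ L) → ¬ x ⊒ y → step R x y ≈ 0#
  step-support R x y ¬⊒ = zeroʳ′ (columns-support (conserving R) x y ¬⊒)

  step-pad : ∀ R d (x y : Vec ℕ L) → step R (pad d x) (pad d y) ≈ step R x y
  step-pad R d x y = *-cong (reflexive (≡.cong (φ R) (≡.cong₂ _∸_ (sum-pad d x) (sum-pad d y))))
                            (columns-pad d (vacuous R) x y)

  -- An entry of the product of the n matrices `step`. The cutoff B on intermediate labels is left
  -- free, since partition functions with different cutoffs have to be compared.
  paths : ℕ → (Fin n → Row) → Vec ℕ L → Vec ℕ L → Carrier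
  paths {zero}      B R x y = 𝟙 (x ≟ᵛ y)
  paths {suc n} {L} B R x y = ∑ (box B L) λ z → step (R Fin.zero) x z * paths B (R ∘ Fin.suc) z y

  paths-cong : ∀ {B} {R R′ : Fin n → Row} →
               (∀ r i → φ (R r) i ≈ φ (R′ r) i) →
               (∀ r c i j k l → weight (R r) c i j k l ≈ weight (R′ r) c i j k l) →
               (x y : Vec ℕ L) → paths B R x y ≈ paths B R′ x y
  paths-cong {zero}          φ≈ w≈ x y = refl
  paths-cong {suc n} {L} {B} φ≈ w≈ x y = ∑-cong (box B L) λ z → *-cong
    (*-cong (φ≈ Fin.zero _) (columns-cong (w≈ Fin.zero) x z))
    (paths-cong (φ≈ ∘ Fin.suc) (w≈ ∘ Fin.suc) z y)

  -- A nonzero term needs x ⊒ z and z ⊒ y, and domination is transitive.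
  paths-support : ∀ B (R : Fin n → Row) (x y : Vec ℕ L) → ¬ x ⊒ y → paths B R x y ≈ 0#
  paths-support {zero}      B R x y ¬⊒ = 𝟙-no (x ≟ᵛ y) λ { ≡.refl → ¬⊒ (⊒-refl x) }
  paths-support {suc n} {L} B R x y ¬⊒ = ∑-zero (box B L) term
    where
    term : ∀ z → z ∈ box B L → step (R Fin.zero) x z * paths B (R ∘ Fin.suc) z y ≈ 0#
    term z _ with x ⊒? z
    ... | no ¬x⊒z = zeroˡ′ (step-support (R Fin.zero) x z ¬x⊒z)
    ... | yes x⊒z = zeroʳ′ (paths-support B (R ∘ Fin.suc) z y (¬⊒ ∘ ⊒-trans x z y x⊒z))

  -- Associativity of the matrix product, by induction on m. For m = 0 the first factor is the
  -- identity matrix, which selects x because x lies in the box.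
  paths-++ : ∀ m {k B} (R : Fin (m ℕ.+ k) → Row) (x y : Vec ℕ L) → x ∈ box B L →
             paths B R x y ≈
             ∑ (box B L) λ z → paths B (R ∘ (_↑ˡ k)) x z * paths B (R ∘ (m ↑ʳ_)) z y
  paths-++ {L} zero {k} {B} R x y x∈ = sym (begin
    ∑ (box B L) (λ z → 𝟙 (x ≟ᵛ z) * paths B R z y)
      ≈⟨ ∑-cong (box B L) (λ z → *-congʳ (𝟙-cong (x ≟ᵛ z) (z ≟ᵛ x) ≡.sym ≡.sym)) ⟩
    ∑ (box B L) (λ z → 𝟙 (z ≟ᵛ x) * paths B R z y)
      ≈⟨ ∑-𝟙 _≟ᵛ_ _ (box-unique B L) x∈ ⟩
    paths B R x y ∎)
  paths-++ {L} (suc m) {k} {B} R x y x∈ = begin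
    ∑ V (λ u → step R₀ x u * paths B R₊ u y)
      ≈⟨ ∑-cong-∈ V (λ u u∈ → *-congˡ (paths-++ m R₊ u y u∈)) ⟩
    ∑ V (λ u → step R₀ x u * ∑ V λ z → P u z * Q z)
      ≈⟨ ∑-cong V (λ u → *-distribˡ-∑ V _ _) ⟩
    ∑ V (λ u → ∑ V λ z → step R₀ x u * (P u z * Q z))
      ≈⟨ ∑-swap V V _ ⟩
    ∑ V (λ z → ∑ V λ u → step R₀ x u * (P u z * Q z))
      ≈⟨ ∑-cong V (λ z → ∑-cong V λ u → sym (*-assoc _ _ _)) ⟩
    ∑ V (λ z → ∑ V λ u → (step R₀ x u * P u z) * Q z)
      ≈⟨ ∑-cong V (λ z → sym (*-distribʳ-∑ V _ _)) ⟩
    ∑ V (λ z → ∑ V (λ u → step R₀ x u * P u z) * Q z) ∎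
    where
    V = box B L
    R₀ = R Fin.zero
    R₊ : Fin (m ℕ.+ k) → Row
    R₊ = R ∘ Fin.suc
    P : Vec ℕ L → Vec ℕ L → Carrier
    P u z = paths B (R₊ ∘ (_↑ˡ k)) u z
    Q : Vec ℕ L → Carrier
    Q z = paths B (R₊ ∘ (m ↑ʳ_)) z y

  -- Every z dominated by `pad d x` is itself padded and has sum at most sum x, so both boxes
  -- contain all nonzero terms.
  paths-pad : ∀ d {B B′} (R : Fin n → Row) (x y : Vec ℕ L) → sum x ≤ B → sum x ≤ B′ →
              paths B′ R (pad d x) (pad d y) ≈ paths B R x y
  paths-pad {zero} d R x y _ _ =
    𝟙-cong (pad d x ≟ᵛ pad d y) (x ≟ᵛ y) (pad-injective d x y) (≡.cong (pad d))
  paths-pad {suc n} {L} d {B} {B′} R x y Σ≤B Σ≤B′ = begin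
    ∑ (box B′ (L ℕ.+ d)) f
      ≈⟨ ∑-support _≟ᵛ_ f (box-unique B′ (L ℕ.+ d)) (Unique.map⁺ (pad-injective d _ _) (box-unique B L)) outside′ outside ⟩
    ∑ (List.map (pad d) (box B L)) f
      ≈⟨ reflexive (∑-map (pad d) (box B L) f) ⟩
    ∑ (box B L) (λ z → f (pad d z))
      ≈⟨ ∑-cong (box B L) term ⟩
    ∑ (box B L) (λ z → step (R Fin.zero) x z * paths B (R ∘ Fin.suc) z y) ∎
    where
    f : Vec ℕ (L ℕ.+ d) → Carrier
    f z = step (R Fin.zero) (pad d x) z * paths B′ (R ∘ Fin.suc) z (pad d y)
    outside′ : ∀ z → z ∉ box B′ (L ℕ.+ d) → f z ≈ 0#
    outside′ z z∉ = zeroˡ′ (step-support (R Fin.zero) (pad d x) z λ x⊒z →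
      z∉ (∈-box z (ℕₚ.≤-trans (⊒⇒sum≤ (pad d x) z x⊒z) (ℕₚ.≤-trans (ℕₚ.≤-reflexive (sum-pad d x)) Σ≤B′))))
    outside : ∀ z → z ∉ List.map (pad d) (box B L) → f z ≈ 0#
    outside z z∉ = zeroˡ′ (step-support (R Fin.zero) (pad d x) z (z∉ ∘ in-box))
      where
      in-box : pad d x ⊒ z → z ∈ List.map (pad d) (box B L)
      in-box p with Vec.splitAt L z
      ... | z₁ , z₂ , ≡.refl with ⊒-pad d x z₁ z₂ p
      ... | ≡.refl , q = ∈-map⁺ (pad d) (∈-box z₁ (ℕₚ.≤-trans (⊒⇒sum≤ x z₁ q) Σ≤B))
    term : ∀ z → f (pad d z) ≈ step (R Fin.zero) x z * paths B (R ∘ Fin.suc) z y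
    -- The induction hypothesis asks for bounds on sum z, which x ⊒ z supplies; otherwise both sides
    -- vanish.
    term z with x ⊒? z
    ... | no ¬p = trans (zeroˡ′ (trans (step-pad (R Fin.zero) d x z) step≈0)) (sym (zeroˡ′ step≈0))
      where
      step≈0 : step (R Fin.zero) x z ≈ 0#
      step≈0 = step-support (R Fin.zero) x z ¬p
    ... | yes p = *-cong (step-pad (R Fin.zero) d x z)
      (paths-pad d (R ∘ Fin.suc) z y (ℕₚ.≤-trans Σz≤ Σ≤B) (ℕₚ.≤-trans Σz≤ Σ≤B′))
      where
      Σz≤ : sum z ≤ sum x
      Σz≤ = ⊒⇒sum≤ x z p

  -- Conservation determines the left labels, and it makes the constraint on
  -- their sum redundant.
  ∑-grid≈paths : ∀ {B} (R : Fin n → Row) (x y : Vec ℕ L) → sum x ≤ B →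
    ∑ (box B n) (λ a → (𝟙 (sum a ℕ.+ sum y ℕₚ.≟ sum x) * product {n} (λ r → φ (R r) (lookup a r))) *
                       grid B (weight ∘ R) x y a) ≈
    paths B R x y
  ∑-grid≈paths {zero} {B = B} R x y _ = trans (+-identityʳ _) (trans
    (*-cong (*-identityʳ _) (grid-zero B (weight ∘ R) x y)) (redundant (x ≟ᵛ y)))
    where
    -- Without rows the constraint reads sum y = sum x, which x = y implies.
    redundant : (D : Dec (x ≡ y)) → 𝟙 (sum y ℕₚ.≟ sum x) * 𝟙 D ≈ 𝟙 D
    redundant (yes ≡.refl) = trans (*-identityʳ _) (𝟙-yes (sum x ℕₚ.≟ sum x) ≡.refl)
    redundant (no _)       = zeroʳ _
  ∑-grid≈paths {suc n} {L} {B} R x y Σ≤B = begin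
    ∑ (box B (suc n)) (λ a → E a * grid B (weight ∘ R) x y a)
      ≈⟨ ∑-vecs labels n _ ⟩
    ∑ labels (λ a → ∑ (box B n) λ as → E (a ∷ as) * grid B (weight ∘ R) x y (a ∷ as))
      ≈⟨ ∑-cong-∈ labels (λ a a∈ → ∑-cong (box B n) λ as → trans
           (*-congˡ (trans (grid-suc B (weight ∘ R) x y as a∈)
                           (∑-cong V λ z → *-congʳ (rowSum≈columns (conserving R₀) x z a Σ≤B))))
           (*-distribˡ-∑ V _ _)) ⟩
    ∑ labels (λ a → ∑ (box B n) λ as → ∑ V (F a as))
      ≈⟨ ∑-cong labels (λ a → ∑-swap (box B n) V _) ⟩
    ∑ labels (λ a → ∑ V λ z → ∑ (box B n) λ as → F a as z)
      ≈⟨ ∑-swap labels V _ ⟩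
    ∑ V (λ z → ∑ labels λ a → ∑ (box B n) λ as → F a as z)
      ≈⟨ ∑-cong V (λ z → collapse z (sum z ℕₚ.≤? sum x)) ⟩
    ∑ V (λ z → step R₀ x z * paths B R₊ z y) ∎
    where
    labels = upTo (suc B)
    V = box B L
    R₀ = R Fin.zero
    R₊ : Fin n → Row
    R₊ = R ∘ Fin.suc
    E : Vec ℕ (suc n) → Carrier
    E a = 𝟙 (sum a ℕ.+ sum y ℕₚ.≟ sum x) * product {suc n} (λ r → φ (R r) (lookup a r))
    F : ℕ → Vec ℕ n → Vec ℕ L → Carrier
    F a as z = E (a ∷ as) *
      ((𝟙 (sum z ℕ.+ a ℕₚ.≟ sum x) * columns (weight R₀) x z) * grid B (weight ∘ R₊) z y as)
    collapse : ∀ z → Dec (sum z ≤ sum x) →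
      ∑ labels (λ a → ∑ (box B n) λ as → F a as z) ≈ step R₀ x z * paths B R₊ z y
    collapse z (no ≰) = trans
      (∑-zero labels (λ a _ → ∑-zero (box B n) λ as _ → zeroʳ′ (zeroˡ′ (zeroʳ′ cols≈0))))
      (sym (zeroˡ′ (zeroʳ′ cols≈0)))
      where
      cols≈0 : columns (weight R₀) x z ≈ 0#
      cols≈0 = columns-support (conserving R₀) x z (≰ ∘ ⊒⇒sum≤ x z)
    collapse z (yes p) = begin
      ∑ labels (λ a → ∑ (box B n) λ as → F a as z)
        ≈⟨ ∑-only _ (Unique.upTo⁺ (suc B))
             (∈-upTo⁺ (s≤s (ℕₚ.≤-trans (ℕₚ.m∸n≤m (sum x) (sum z)) Σ≤B)))
             (λ a a≢ → ∑-zero (box B n) λ as _ → zeroʳ′ (zeroˡ′ (zeroˡ′ (𝟙-no (_ ℕₚ.≟ _) λ eq → a≢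
               (≡.trans (≡.sym (ℕₚ.m+n∸m≡n (sum z) a)) (≡.cong (_∸ sum z) eq)))))) ⟩
      ∑ (box B n) (λ as → F a* as z)
        -- Once the first left label is `a*`, cancelling it turns the constraint into the same one
        -- for the remaining rows, which start at z.
        ≈⟨ ∑-cong (box B n) (λ as → trans
             (*-cong (*-congʳ (𝟙-cong (sum (a* ∷ as) ℕ.+ sum y ℕₚ.≟ sum x) (sum as ℕ.+ sum y ℕₚ.≟ sum z) (to as) (from as)))
                     (*-congʳ (trans (*-congʳ (𝟙-yes (_ ℕₚ.≟ _) (ℕₚ.m+[n∸m]≡n p))) (*-identityˡ _))))
             (solve 5 (λ e p q c g → (e ⊕ (p ⊕ q)) ⊕ (c ⊕ g) ⊜ (p ⊕ c) ⊕ ((e ⊕ q) ⊕ g)) refl _ _ _ _ _)) ⟩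
      ∑ (box B n) (λ as → step R₀ x z * _)
        ≈⟨ sym (*-distribˡ-∑ (box B n) _ _) ⟩
      step R₀ x z * ∑ (box B n) (λ as → _)
        ≈⟨ *-congˡ (∑-grid≈paths R₊ z y (ℕₚ.≤-trans p Σ≤B)) ⟩
      step R₀ x z * paths B R₊ z y ∎
      where
      a* = sum x ∸ sum z
      to : ∀ as → sum (a* ∷ as) ℕ.+ sum y ≡ sum x → sum as ℕ.+ sum y ≡ sum z
      to as eq = ℕₚ.+-cancelˡ-≡ a* _ _ (≡.trans (≡.sym (ℕₚ.+-assoc a* (sum as) (sum y)))
        (≡.trans eq (≡.sym (ℕₚ.m∸n+n≡m p))))
      from : ∀ as → sum as ℕ.+ sum y ≡ sum z → sum (a* ∷ as) ℕ.+ sum y ≡ sum x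
      from as eq = ≡.trans (ℕₚ.+-assoc a* (sum as) (sum y))
        (≡.trans (≡.cong (a* ℕ.+_) eq) (ℕₚ.m∸n+n≡m p))

-- Nonvanishing and division in the field

module Branching {c ℓ₁ ℓ₂} (K : Field c ℓ₁ ℓ₂) where

  open Field K
  open SpinQWhittaker K
  open Parameters
  open Sums K
  open Lattice K
  open Row
  open CommutativeRing commutativeRing using (semiring; *-monoid)
  open ApartnessProperties heytingCommutativeRing
    using (1#0; x-0≈x; x#0y#0→xy#0; invertibleʳ⇒#; #-congʳ)
  open MonoidSum *-monoid using () renaming (sum-cong-≋ to product-cong)
  open Exp semiring using (^-congˡ)
  open import Relation.Binary.Reasoning.Setoid setoid
  open MonoidSolver *-commutativeMonoid using (solve; _⊜_; _⊕_; id)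

  private variable
    n : ℕ

  xy≈1⇒x#0 : ∀ {x y} → x * y ≈ 1# → x # 0#
  xy≈1⇒x#0 {x} {y} eq = invertibleʳ⇒# (y , trans (*-congʳ (x-0≈x x)) eq)

  ⁻¹#0 : ∀ {x} → x # 0# → x ⁻¹ # 0#
  ⁻¹#0 x#0 = xy≈1⇒x#0 (trans (*-comm _ _) (⁻¹-inverse x#0))

  x#y⇒x-y#0 : ∀ {x y} → x # y → x - y # 0#
  x#y⇒x-y#0 x#y with i , _ , eq ← #⇒invertible x#y = xy≈1⇒x#0 eq

  -‿#0 : ∀ {x} → x # 0# → - x # 0#
  -‿#0 x#0 = #-congʳ (+-identityˡ _) (x#y⇒x-y#0 (#-sym x#0))

  product#0 : (f : Fin n → Carrier) → (∀ i → f i # 0#) → product f # 0#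
  product#0 {zero}  f f#0 = 1#0
  product#0 {suc n} f f#0 = x#0y#0→xy#0 (f#0 Fin.zero) (product#0 (f ∘ Fin.suc) (f#0 ∘ Fin.suc))

  ^#0 : ∀ {x} n → x # 0# → x ^ n # 0#
  ^#0 zero    x#0 = 1#0
  ^#0 (suc n) x#0 = x#0y#0→xy#0 x#0 (^#0 n x#0)

  1⁻¹≈1 : 1# ⁻¹ ≈ 1#
  1⁻¹≈1 = trans (sym (*-identityˡ _)) (⁻¹-inverse 1#0)

  /-cong : ∀ {x x′ y y′} → x ≈ x′ → y ≈ y′ → x / y ≈ x′ / y′
  /-cong x≈ y≈ = *-cong x≈ (⁻¹-cong y≈)

  cross-multiply : ∀ {a b c d} → b # 0# → d # 0# → a * d ≈ c * b → a / b ≈ c / d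
  cross-multiply {a} {b} {c} {d} b#0 d#0 eq = begin
    a * b ⁻¹                 ≈⟨ *-congˡ (sym (trans (*-congʳ (⁻¹-inverse d#0)) (*-identityˡ _))) ⟩
    a * (d * d ⁻¹ * b ⁻¹)    ≈⟨ solve 4 (λ a d d′ b′ → a ⊕ ((d ⊕ d′) ⊕ b′) ⊜ (a ⊕ d) ⊕ (b′ ⊕ d′)) refl a d (d ⁻¹) (b ⁻¹) ⟩
    (a * d) * (b ⁻¹ * d ⁻¹)  ≈⟨ *-congʳ eq ⟩
    (c * b) * (b ⁻¹ * d ⁻¹)  ≈⟨ solve 4 (λ c b b′ d′ → (c ⊕ b) ⊕ (b′ ⊕ d′) ⊜ c ⊕ ((b ⊕ b′) ⊕ d′)) refl c b (b ⁻¹) (d ⁻¹) ⟩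
    c * (b * b ⁻¹ * d ⁻¹)    ≈⟨ *-congˡ (trans (*-congʳ (⁻¹-inverse b#0)) (*-identityˡ _)) ⟩
    c * d ⁻¹                 ∎

  -- Vertex weights and the rows of the model

  poch-cong : ∀ q {x y} n → x ≈ y → poch q x n ≈ poch q y n
  poch-cong q n x≈y = product-cong {n} (λ i → +-congˡ (-‿cong (*-congʳ x≈y)))

  poch#0 : ∀ q x n → (∀ j → x * q ^ j # 1#) → poch q x n # 0#
  poch#0 q x n gen = product#0 {n} _ (λ i → x#y⇒x-y#0 (#-sym (gen (toℕ i))))

  -- Propositional equality is asked of s² because the shift law `τ-τ` provides it; t² agrees only
  -- up to the equality of the field.
  W-cong : ∀ q {t² t²′ s² s²′} i j k l → t² ≈ t²′ → s² ≡ s²′ → W q t² s² i j k l ≈ W q t²′ s²′ i j k l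
  W-cong q i j k l t≈ ≡.refl = *-congˡ (*-congʳ (*-cong (^-congˡ l (/-cong refl t≈))
    (/-cong (*-cong (poch-cong q (i ∸ l) (/-cong refl t≈)) (poch-cong q l t≈)) refl)))

  -- The indices r and c stand for row r + 1 and column c + 1. The index r is a natural number, so
  -- that rows m + r and r of grids of different heights can be compared.
  row : Carrier → Parameters → Carrier → ℕ → Row
  row q P κᵣ r = record
    { φ          = λ a → (κᵣ * s P 0 / ξ P 0) ^ a *
                         (poch q (κᵣ ⁻¹ * s P (suc r) * ξ P (suc r)) a / poch q q a)
    ; weight     = λ c → W q (ξ P (suc r ℕ.+ suc c) * s P (suc r ℕ.+ suc c) / κᵣ)
                             (s (τ (suc r) P) (suc c) ^ 2)
    ; conserving = λ c i+j≢k+l → zeroˡ′ (zeroˡ′ (𝟙-no (_ ℕₚ.≟ _) i+j≢k+l))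
    ; vacuous    = λ c → begin
        -- With all labels 0 the Pochhammer symbols are empty products.
        (1# * 1#) * ((1# * ((1# * 1#) / 1#)) * (1# / (1# * 1#)))
          ≈⟨ *-congˡ (*-congˡ (*-congˡ (⁻¹-cong (*-identityˡ 1#)))) ⟩
        (1# * 1#) * ((1# * ((1# * 1#) / 1#)) * (1# / 1#))
          ≈⟨ solve 1 (λ u → (id ⊕ id) ⊕ ((id ⊕ ((id ⊕ id) ⊕ u)) ⊕ (id ⊕ u)) ⊜ u ⊕ u) refl (1# ⁻¹) ⟩
        1# ⁻¹ * 1# ⁻¹
          ≈⟨ *-cong 1⁻¹≈1 1⁻¹≈1 ⟩
        1# * 1#
          ≈⟨ *-identityˡ 1# ⟩
        1# ∎
    }

  rows : Carrier → Parameters → Vec Carrier n → Fin n → Row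
  rows q P κ r = row q P (lookup κ r) (toℕ r)

  -- Both lengths are at most L, so the extra columns are empty and `paths-pad` applies.
  paths-mults : ∀ {L L′ B B′ la mu} (R : Fin n → Row) → len la ≤ L → len mu ≤ L → L ≤ L′ →
                part la 0 ≤ B → part la 0 ≤ B′ →
                paths B′ R (mults L′ la) (mults L′ mu) ≈ paths B R (mults L la) (mults L mu)
  paths-mults {L = L} {B = B} {B′} {la} {mu} R la≤L mu≤L L≤L′ λ₁≤B λ₁≤B′
    with d , ≡.refl ← ℕₚ.m≤n⇒∃[o]m+o≡n L≤L′ = trans
    (reflexive (≡.cong₂ (paths B′ R) (mults-pad L d la la≤L) (mults-pad L d mu mu≤L)))
    (paths-pad d R (mults L la) (mults L mu)
      (ℕₚ.≤-trans (ℕₚ.≤-reflexive (sum-mults L la la≤L)) λ₁≤B)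
      (ℕₚ.≤-trans (ℕₚ.≤-reflexive (sum-mults L la la≤L)) λ₁≤B′))

  -- The indicator on the top row selects the multiplicities of λ, which lie in the box because they
  -- sum to λ₁.
  ZW≈grid : ∀ q {L} (a : Vec ℕ n) la mu κ P → len la ≤ L →
            ZW q L a la mu κ P ≈
            grid (part la 0) (weight ∘ rows q P κ) (mults L la) (mults L mu) a
  ZW≈grid {n} q {L} a la mu κ P la≤L = begin
    ZW q L a la mu κ P
      ≈⟨ ∑-vecs V n _ ⟩
    ∑ V (λ x → ∑ (vecs V n) λ v → ∑ (vecs G n) λ h → 𝟙 (boundary? la mu a (x ∷ v) h) * Π x v h)
      ≈⟨ ∑-cong V (λ x → trans
           (∑-cong (vecs V n) λ v → trans
             (∑-cong (vecs G n) λ h → trans (*-congʳ (split-boundary x v h)) (*-assoc _ _ _))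
             (sym (*-distribˡ-∑ (vecs G n) _ _)))
           (sym (*-distribˡ-∑ (vecs V n) _ _))) ⟩
    ∑ V (λ x → 𝟙 (x ≟ᵛ mults L la) * grid (part la 0) (weight ∘ rows q P κ) x (mults L mu) a)
      ≈⟨ ∑-𝟙 _≟ᵛ_ _ (box-unique (part la 0) L)
           (∈-box (mults L la) (ℕₚ.≤-reflexive (sum-mults L la la≤L))) ⟩
    grid (part la 0) (weight ∘ rows q P κ) (mults L la) (mults L mu) a ∎
    where
    V = box (part la 0) L
    G = box (part la 0) (suc L)
    Π : Vec ℕ L → Vec (Vec ℕ L) n → Vec (Vec ℕ (suc L)) n → Carrier
    Π x v h = product {n} λ r → product {L} λ c → weight (rows q P κ r) (toℕ c)
      (bottom (x ∷ v) h r c) (left (x ∷ v) h r c) (top (x ∷ v) h r c) (right (x ∷ v) h r c)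
    split-boundary : ∀ x v h → 𝟙 (boundary? la mu a (x ∷ v) h) ≈
      𝟙 (x ≟ᵛ mults L la) *
      (𝟙 (lookup (x ∷ v) (fromℕ n) ≟ᵛ mults L mu) *
       (𝟙 (Vec.map (λ g → lookup g Fin.zero) h ≟ᵛ a) *
        𝟙 (Vec.map (λ g → lookup g (fromℕ L)) h ≟ᵛ replicate n 0)))
    split-boundary x v h =
      trans (𝟙-× (x ≟ᵛ mults L la) (last? ×-dec lefts? ×-dec rights?))
        (*-congˡ (trans (𝟙-× last? (lefts? ×-dec rights?)) (*-congˡ (𝟙-× lefts? rights?))))
      where
      last?   = lookup (x ∷ v) (fromℕ n) ≟ᵛ mults L mu
      lefts?  = Vec.map (λ g → lookup g Fin.zero) h ≟ᵛ a
      rights? = Vec.map (λ g → lookup g (fromℕ L)) h ≟ᵛ replicate n 0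

  -- In `𝔽ˢ` the number of columns and the label bound depend on the partitions. Free L and B put
  -- the functions for different partitions on one common grid.
  𝔽ˢ≈paths : ∀ q {L B} la mu (κ : Vec Carrier n) P → len la ≤ L → len mu ≤ L → part la 0 ≤ B →
             𝔽ˢ q la mu κ P ≈ paths B (rows q P κ) (mults L la) (mults L mu)
  𝔽ˢ≈paths {n} q {L} {B} la mu κ P la≤L mu≤L λ₁≤B = begin
    𝔽ˢ q la mu κ P
      ≈⟨ ∑-cong (box (part la 0) n) (λ a → *-cong
           (*-congʳ (𝟙-cong (sum a ℕ.+ part mu 0 ℕₚ.≟ part la 0) (sum a ℕ.+ sum y ℕₚ.≟ sum x)
             (λ eq → ≡.trans (≡.cong (sum a ℕ.+_) Σy≡) (≡.trans eq (≡.sym Σx≡)))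
             (λ eq → ≡.trans (≡.cong (sum a ℕ.+_) (≡.sym Σy≡)) (≡.trans eq Σx≡))))
           (ZW≈grid q a la mu κ P la≤M)) ⟩
    ∑ (box (part la 0) n) (λ a →
      (𝟙 (sum a ℕ.+ sum y ℕₚ.≟ sum x) * product {n} (λ r → φ (rows q P κ r) (lookup a r))) *
      grid (part la 0) (weight ∘ rows q P κ) x y a)
      ≈⟨ ∑-grid≈paths (rows q P κ) x y (ℕₚ.≤-reflexive Σx≡) ⟩
    paths (part la 0) (rows q P κ) x y
      -- As L may be smaller than M, both are compared with the least admissible width
      -- `len la ⊔ len mu`.
      ≈⟨ paths-mults {la = la} {mu} (rows q P κ) (ℕₚ.m≤m⊔n _ _) (ℕₚ.m≤n⊔m (len la) _) (ℕₚ.n≤1+n _) λ₁≤B ℕₚ.≤-refl ⟩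
    paths B (rows q P κ) (mults (len la ⊔ len mu) la) (mults (len la ⊔ len mu) mu)
      ≈⟨ sym (paths-mults {la = la} {mu} (rows q P κ) (ℕₚ.m≤m⊔n _ _) (ℕₚ.m≤n⊔m (len la) _) (ℕₚ.⊔-lub la≤L mu≤L) λ₁≤B λ₁≤B) ⟩
    paths B (rows q P κ) (mults L la) (mults L mu) ∎
    where
    M = suc (len la ⊔ len mu)
    la≤M : len la ≤ M
    la≤M = ℕₚ.m≤n⇒m≤1+n (ℕₚ.m≤m⊔n _ _)
    mu≤M : len mu ≤ M
    mu≤M = ℕₚ.m≤n⇒m≤1+n (ℕₚ.m≤n⊔m (len la) _)
    x = mults M la
    y = mults M mu
    Σx≡ : sum x ≡ part la 0
    Σx≡ = sum-mults M la la≤M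
    Σy≡ : sum y ≡ part mu 0
    Σy≡ = sum-mults M mu mu≤M

  -- Domination bounds both the length and the first part, and these two bounds already confine μ to
  -- a finite set.
  𝔽ˢ-support : ∀ q la mu (κ : Vec Carrier n) P → ¬ (len mu ≤ len la × part mu 0 ≤ part la 0) →
               𝔽ˢ q la mu κ P ≈ 0#
  𝔽ˢ-support q la mu κ P ¬⊆ = trans
    (𝔽ˢ≈paths q la mu κ P la≤M mu≤M ℕₚ.≤-refl)
    (paths-support (part la 0) (rows q P κ) (mults M la) (mults M mu) λ p → ¬⊆
      ( ≡.subst₂ (λ nu nu′ → len nu ≤ len nu′) (toPartition-mults M mu mu≤M) (toPartition-mults M la la≤M)
          (⊒⇒len≤ (mults M la) (mults M mu) p)
      , ≡.subst₂ _≤_ (sum-mults M mu mu≤M) (sum-mults M la la≤M) (⊒⇒sum≤ (mults M la) (mults M mu) p)))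
    where
    M = len la ⊔ len mu
    la≤M : len la ≤ M
    la≤M = ℕₚ.m≤m⊔n _ _
    mu≤M : len mu ≤ M
    mu≤M = ℕₚ.m≤n⊔m (len la) _

  negPow-cong : ∀ {S S′ : ℕ → Carrier} la → (∀ i → S i ≡ S′ i) → negPow S la ≈ negPow S′ la
  negPow-cong la S≡ = product-cong {len la} λ i →
    reflexive (≡.cong (λ x → (- x) ^ part la (toℕ i)) (S≡ (toℕ i)))

  𝖼-cong : ∀ q {S S′ : ℕ → Carrier} la → (∀ i → S i ≡ S′ i) → 𝖼 q S la ≈ 𝖼 q S′ la
  𝖼-cong q la S≡ = product-cong {len la} λ i → reflexive
    (≡.cong (λ x → poch q (x ^ 2) (mult′ la (toℕ i)) / poch q q (mult′ la (toℕ i))) (S≡ (suc (toℕ i))))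

  -- Rows under the shift of the parameters

  module _ (q : Carrier) (√ξ √s : ℕ → Carrier)
           (√ξ#0 : ∀ i → √ξ i # 0#) (√s#0 : ∀ i → √s i # 0#) (m : ℕ) where

    private
      P P′ : Parameters
      P  = fromRoots √ξ √s
      P′ = τ m P

      u#0 : ∀ i → √ξs P i # 0#
      u#0 i = x#0y#0→xy#0 (√ξ#0 i) (√s#0 i)

      r#0 : ∀ i → √ξ/s P i # 0#
      r#0 i = x#0y#0→xy#0 (√ξ#0 i) (⁻¹#0 (√s#0 i))

    s-τ#0 : ∀ i → s P′ i # 0#
    s-τ#0 i = x#0y#0→xy#0 (u#0 (i ℕ.+ m)) (⁻¹#0 (r#0 i))

    -- The root of ξ_i / s_i cancels, leaving the square of the root of ξ_{i+m} s_{i+m}.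
    ξs-τ : ∀ i → ξ P′ i * s P′ i ≈ ξ P (i ℕ.+ m) * s P (i ℕ.+ m)
    ξs-τ i = begin
      (u * r) * (u * r ⁻¹)   ≈⟨ solve 3 (λ u r r′ → (u ⊕ r) ⊕ (u ⊕ r′) ⊜ (u ⊕ u) ⊕ (r ⊕ r′)) refl u r (r ⁻¹) ⟩
      (u * u) * (r * r ⁻¹)   ≈⟨ trans (*-congˡ (⁻¹-inverse (r#0 i))) (*-identityʳ _) ⟩
      u * u                  ≈⟨ solve 2 (λ x y → (x ⊕ y) ⊕ (x ⊕ y) ⊜ (x ⊕ (x ⊕ id)) ⊕ (y ⊕ (y ⊕ id))) refl (√ξ (i ℕ.+ m)) (√s (i ℕ.+ m)) ⟩
      ξ P (i ℕ.+ m) * s P (i ℕ.+ m) ∎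
      where
      u = √ξs P (i ℕ.+ m)
      r = √ξ/s P i

    -- Here the root at i + m cancels, and both quotients are the inverse square of the root of ξ_i
    -- / s_i.
    s/ξ-τ : ∀ i → s P i / ξ P i ≈ s P′ i / ξ P′ i
    s/ξ-τ i = cross-multiply (^#0 2 (√ξ#0 i)) (x#0y#0→xy#0 (u#0 (i ℕ.+ m)) (r#0 i)) (begin
      (y * (y * 1#)) * (u * (x * y ⁻¹))
        ≈⟨ solve 4 (λ x y y′ u → (y ⊕ (y ⊕ id)) ⊕ (u ⊕ (x ⊕ y′)) ⊜ (u ⊕ (x ⊕ y)) ⊕ (y ⊕ y′)) refl x y (y ⁻¹) u ⟩
      (u * (x * y)) * (y * y ⁻¹)
        -- The quotient of x / y by itself is inserted to produce the inverse that occurs in the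
        -- shifted s.
        ≈⟨ *-congˡ (trans (⁻¹-inverse (√s#0 i)) (sym (trans (*-cong (⁻¹-inverse (√s#0 i)) (⁻¹-inverse (r#0 i))) (*-identityˡ _)))) ⟩
      (u * (x * y)) * ((y * y ⁻¹) * ((x * y ⁻¹) * r⁻¹))
        ≈⟨ solve 5 (λ x y y′ u r′ → (u ⊕ (x ⊕ y)) ⊕ ((y ⊕ y′) ⊕ ((x ⊕ y′) ⊕ r′)) ⊜
                                    ((u ⊕ r′) ⊕ (x ⊕ (x ⊕ id))) ⊕ ((y ⊕ y′) ⊕ (y ⊕ y′))) refl x y (y ⁻¹) u r⁻¹ ⟩
      ((u * r⁻¹) * (x * (x * 1#))) * ((y * y ⁻¹) * (y * y ⁻¹))
        ≈⟨ trans (*-congˡ (trans (*-cong (⁻¹-inverse (√s#0 i)) (⁻¹-inverse (√s#0 i))) (*-identityˡ 1#))) (*-identityʳ _) ⟩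
      (u * r⁻¹) * (x * (x * 1#)) ∎)
      where
      x = √ξ i
      y = √s i
      u = √ξs P (i ℕ.+ m)
      r⁻¹ = (x / y) ⁻¹

    φ-τ : ∀ κᵣ r a → φ (row q P κᵣ (m ℕ.+ r)) a ≈ φ (row q P′ κᵣ r) a
    φ-τ κᵣ r a = *-cong
      (^-congˡ a (trans (*-assoc _ _ _) (trans (*-congˡ (s/ξ-τ 0)) (sym (*-assoc _ _ _)))))
      (*-congʳ (poch-cong q a (begin
        κᵣ ⁻¹ * s P (suc (m ℕ.+ r)) * ξ P (suc (m ℕ.+ r))
          ≈⟨ reflexive (≡.cong (λ j → κᵣ ⁻¹ * s P (suc j) * ξ P (suc j)) (ℕₚ.+-comm m r)) ⟩
        κᵣ ⁻¹ * s P (suc r ℕ.+ m) * ξ P (suc r ℕ.+ m)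
          ≈⟨ trans (*-assoc _ _ _) (*-congˡ (*-comm _ _)) ⟩
        κᵣ ⁻¹ * (ξ P (suc r ℕ.+ m) * s P (suc r ℕ.+ m))
          ≈⟨ *-congˡ (sym (ξs-τ (suc r))) ⟩
        κᵣ ⁻¹ * (ξ P′ (suc r) * s P′ (suc r))
          ≈⟨ sym (trans (*-assoc _ _ _) (*-congˡ (*-comm _ _))) ⟩
        κᵣ ⁻¹ * s P′ (suc r) * ξ P′ (suc r) ∎)))

    -- The product ξ s in t² is only reindexed, and shifting by m and then by r + 1 is shifting by m
    -- + r + 1.
    weight-τ : ∀ κᵣ r c i j k l →
               weight (row q P κᵣ (m ℕ.+ r)) c i j k l ≈ weight (row q P′ κᵣ r) c i j k l
    weight-τ κᵣ r c i j k l = W-cong q i j k l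
      (*-congʳ (trans (reflexive (≡.cong (λ j → ξ P j * s P j) index)) (sym (ξs-τ (suc r ℕ.+ suc c)))))
      (≡.cong (_^ 2) (≡.trans (≡.cong (λ j → s (τ j P) (suc c)) (≡.sym (ℕₚ.+-suc m r)))
                              (≡.sym (proj₂ (τ-τ m (suc r) P (suc c))))))
      where
      index : suc (m ℕ.+ r) ℕ.+ suc c ≡ suc r ℕ.+ suc c ℕ.+ m
      index = ≡.cong suc (≡.trans (≡.cong (ℕ._+ suc c) (ℕₚ.+-comm m r))
        (≡.trans (ℕₚ.+-assoc r m (suc c)) (≡.trans (≡.cong (r ℕ.+_) (ℕₚ.+-comm m (suc c)))
          (≡.sym (ℕₚ.+-assoc r (suc c) m)))))

    negPow-τ#0 : ∀ la → negPow (s P′) la # 0#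
    negPow-τ#0 la = product#0 {len la} _ λ i → ^#0 (part la (toℕ i)) (-‿#0 (s-τ#0 (toℕ i)))

    𝖼-τ#0 : (∀ j → q ^ suc j # 1#) → (∀ i j → s P′ i ^ 2 * q ^ j # 1#) → ∀ la → 𝖼 q (s P′) la # 0#
    𝖼-τ#0 q-gen s-gen la = product#0 {len la} _ λ i → x#0y#0→xy#0
      (poch#0 q _ (mult′ la (toℕ i)) (s-gen (suc (toℕ i))))
      (⁻¹#0 (poch#0 q q (mult′ la (toℕ i)) q-gen))

    module _ {k B L : ℕ} (κ : Vec Carrier m) (κ′ : Vec Carrier k) (x y : Vec ℕ L) where

      paths-++ˡ : paths B (rows q P (κ ++ κ′) ∘ (_↑ˡ k)) x y ≈ paths B (rows q P κ) x y
      paths-++ˡ = paths-cong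
        (λ r i → reflexive (≡.cong (λ R → φ R i) (row≡ r)))
        (λ r c i j k l → reflexive (≡.cong (λ R → weight R c i j k l) (row≡ r))) x y
        where
        row≡ : ∀ r → rows q P (κ ++ κ′) (r ↑ˡ k) ≡ rows q P κ r
        row≡ r = ≡.cong₂ (row q P) (Vecₚ.lookup-++ˡ κ κ′ r) (Finₚ.toℕ-↑ˡ r k)

      paths-++ʳ : paths B (rows q P (κ ++ κ′) ∘ (m ↑ʳ_)) x y ≈ paths B (rows q P′ κ′) x y
      paths-++ʳ = paths-cong
        (λ r i → trans (reflexive (≡.cong (λ R → φ R i) (row≡ r))) (φ-τ (lookup κ′ r) (toℕ r) i))
        (λ r c i j k l → trans (reflexive (≡.cong (λ R → weight R c i j k l) (row≡ r)))
                               (weight-τ (lookup κ′ r) (toℕ r) c i j k l)) x y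
        where
        row≡ : ∀ r → rows q P (κ ++ κ′) (m ↑ʳ r) ≡ row q P (lookup κ′ r) (m ℕ.+ toℕ r)
        row≡ r = ≡.cong₂ (row q P) (Vecₚ.lookup-++ʳ κ κ′ r) (Finₚ.toℕ-↑ʳ m r)

-- The branching rule

proposition5p5 : ∀ {c ℓ₁ ℓ₂} (K : Field c ℓ₁ ℓ₂) →
    let open Field K
        open SpinQWhittaker K in
    (q : Carrier) (√ξ √s : ℕ → Carrier) (la mu : Partition)
    {m k : ℕ} (κ : Vec Carrier m) (κ′ : Vec Carrier k) → 1 ≤ m → 1 ≤ k →
    Generic q √ξ √s (κ ++ κ′) →
    let P = fromRoots √ξ √s in
    FiniteSum (λ nu → 𝔽 q la nu κ P * 𝔽 q nu mu κ′ (τ m P)) (𝔽 q la mu (κ ++ κ′) P)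
proposition5p5 K q √ξ √s la mu {m} {k} κ κ′ _ _ gen = record
  -- The image of the whole box may include partitions not contained in λ; their terms vanish.
  { support = List.map toPartition V
  ; unique  = Unique.map⁺ (toPartition-injective _ _) (box-unique λ₁ L)
  ; outside = λ nu nu∉ → zeroˡ′ (zeroʳ′ (𝔽ˢ-support q la nu κ P (nu∉ ∘ in-support nu)))
  ; total   = begin
      pre * 𝔽ˢ q la mu (κ ++ κ′) P
        ≈⟨ *-congˡ (𝔽ˢ≈paths q la mu (κ ++ κ′) P la≤L mu≤L ℕₚ.≤-refl) ⟩
      pre * paths λ₁ (rows q P (κ ++ κ′)) x y
        ≈⟨ *-congˡ (paths-++ m (rows q P (κ ++ κ′)) x y (∈-box x (ℕₚ.≤-reflexive Σx≡λ₁))) ⟩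
      pre * ∑ V (λ z → paths λ₁ (rows q P (κ ++ κ′) ∘ (_↑ˡ k)) x z *
                       paths λ₁ (rows q P (κ ++ κ′) ∘ (m ↑ʳ_)) z y)
        ≈⟨ *-congˡ (∑-cong V (λ z → trans
             (*-cong (paths-++ˡ q √ξ √s √ξ#0 √s#0 m κ κ′ x z) (paths-++ʳ q √ξ √s √ξ#0 √s#0 m κ κ′ z y))
             (paths≈𝔽ˢ z (x ⊒? z)))) ⟩
      pre * ∑ V (λ z → 𝔽ˢ q la (toPartition z) κ P * 𝔽ˢ q (toPartition z) mu κ′ P′)
        ≈⟨ *-distribˡ-∑ V pre _ ⟩
      ∑ V (λ z → pre * (𝔽ˢ q la (toPartition z) κ P * 𝔽ˢ q (toPartition z) mu κ′ P′))
        ≈⟨ ∑-cong V (λ z → prefactors (toPartition z)) ⟩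
      ∑ V (λ z → 𝔽 q la (toPartition z) κ P * 𝔽 q (toPartition z) mu κ′ P′)
        ≈⟨ reflexive (≡.sym (∑-map toPartition V _)) ⟩
      ∑ (List.map toPartition V) (λ nu → 𝔽 q la nu κ P * 𝔽 q nu mu κ′ P′) ∎
  }
  where
  open Field K
  open SpinQWhittaker K
  open Parameters
  open Generic gen
  open Sums K
  open Lattice K
  open Branching K
  open import Relation.Binary.Reasoning.Setoid setoid
  open MonoidSolver *-commutativeMonoid using (solve; _⊜_; _⊕_)

  P P′ : Parameters
  P  = fromRoots √ξ √s
  P′ = τ m P
  λ₁ L : ℕ
  λ₁ = part la 0
  L  = suc (len la ⊔ len mu)
  la≤L : len la ≤ L
  la≤L = ℕₚ.m≤n⇒m≤1+n (ℕₚ.m≤m⊔n _ _)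
  mu≤L : len mu ≤ L
  mu≤L = ℕₚ.m≤n⇒m≤1+n (ℕₚ.m≤n⊔m (len la) _)
  V : List (Vec ℕ L)
  V = box λ₁ L
  x y : Vec ℕ L
  x = mults L la
  y = mults L mu
  Σx≡λ₁ : sum x ≡ λ₁
  Σx≡λ₁ = sum-mults L la la≤L

  pre : Carrier
  pre = (negPow (s (τ (m ℕ.+ k) P)) mu / negPow (s P) la) *
        (𝖼 q (s (τ (m ℕ.+ k) P)) mu / 𝖼 q (s P) la)

  in-support : ∀ nu → len nu ≤ len la × part nu 0 ≤ λ₁ → nu ∈ List.map toPartition V
  in-support nu (nu≤la , ν₁≤λ₁) = ≡.subst (_∈ List.map toPartition V) (toPartition-mults L nu nu≤L)
    (∈-map⁺ toPartition (∈-box (mults L nu) (ℕₚ.≤-trans (ℕₚ.≤-reflexive (sum-mults L nu nu≤L)) ν₁≤λ₁)))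
    where
    nu≤L : len nu ≤ L
    nu≤L = ℕₚ.≤-trans nu≤la la≤L

  -- The entries of z are at most λ₁, but their sum may exceed it, and then the cutoff λ₁ is too
  -- small for the second factor. In that case x ⊒ z fails and the first factor vanishes on both
  -- sides.
  paths≈𝔽ˢ : ∀ z → Dec (x ⊒ z) →
    paths λ₁ (rows q P κ) x z * paths λ₁ (rows q P′ κ′) z y ≈
    𝔽ˢ q la (toPartition z) κ P * 𝔽ˢ q (toPartition z) mu κ′ P′
  paths≈𝔽ˢ z x⊒?z = by-cases x⊒?z
    where
    nu≤L : len (toPartition z) ≤ L
    nu≤L = len-toPartition z
    first : 𝔽ˢ q la (toPartition z) κ P ≈ paths λ₁ (rows q P κ) x z
    first = trans (𝔽ˢ≈paths q la (toPartition z) κ P la≤L nu≤L ℕₚ.≤-refl)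
      (reflexive (≡.cong (paths λ₁ (rows q P κ) x) (mults-toPartition z)))
    second : sum z ≤ λ₁ → 𝔽ˢ q (toPartition z) mu κ′ P′ ≈ paths λ₁ (rows q P′ κ′) z y
    second Σz≤ = trans
      (𝔽ˢ≈paths q (toPartition z) mu κ′ P′ nu≤L mu≤L (ℕₚ.≤-trans (ℕₚ.≤-reflexive (part-toPartition z)) Σz≤))
      (reflexive (≡.cong (λ v → paths λ₁ (rows q P′ κ′) v y) (mults-toPartition z)))
    by-cases : Dec (x ⊒ z) →
      paths λ₁ (rows q P κ) x z * paths λ₁ (rows q P′ κ′) z y ≈
      𝔽ˢ q la (toPartition z) κ P * 𝔽ˢ q (toPartition z) mu κ′ P′
    by-cases (yes p) =
      sym (*-cong first (second (ℕₚ.≤-trans (⊒⇒sum≤ x z p) (ℕₚ.≤-reflexive Σx≡λ₁))))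
    by-cases (no ¬p) = trans (zeroˡ′ paths≈0) (sym (zeroˡ′ (trans first paths≈0)))
      where
      paths≈0 : paths λ₁ (rows q P κ) x z ≈ 0#
      paths≈0 = paths-support λ₁ (rows q P κ) x z ¬p

  prefactors : ∀ nu → pre * (𝔽ˢ q la nu κ P * 𝔽ˢ q nu mu κ′ P′) ≈ 𝔽 q la nu κ P * 𝔽 q nu mu κ′ P′
  prefactors nu = begin
    pre * (A * B)
      -- The left side shifts by m + k at once, the right side by m and then by k.
      ≈⟨ *-congʳ (*-cong (*-congʳ (negPow-cong mu S≡)) (*-congʳ (𝖼-cong q mu S≡))) ⟩
    ((N″ * N ⁻¹) * (C″ * C ⁻¹)) * (A * B)
      -- The factors of ν enter as quotients equal to 1: numerators go to the first 𝔽, inverses to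
      -- the second.
      ≈⟨ sym (trans (*-congʳ (trans (*-cong (⁻¹-inverse N′#0) (⁻¹-inverse C′#0)) (*-identityˡ 1#))) (*-identityˡ _)) ⟩
    ((N′ * N′ ⁻¹) * (C′ * C′ ⁻¹)) * (((N″ * N ⁻¹) * (C″ * C ⁻¹)) * (A * B))
      ≈⟨ solve 10 (λ n″ n⁻ c″ c⁻ n′ n′⁻ c′ c′⁻ a b →
           ((n′ ⊕ n′⁻) ⊕ (c′ ⊕ c′⁻)) ⊕ (((n″ ⊕ n⁻) ⊕ (c″ ⊕ c⁻)) ⊕ (a ⊕ b)) ⊜
           (((n′ ⊕ n⁻) ⊕ (c′ ⊕ c⁻)) ⊕ a) ⊕ (((n″ ⊕ n′⁻) ⊕ (c″ ⊕ c′⁻)) ⊕ b))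
           refl N″ (N ⁻¹) C″ (C ⁻¹) N′ (N′ ⁻¹) C′ (C′ ⁻¹) A B ⟩
    𝔽 q la nu κ P * 𝔽 q nu mu κ′ P′ ∎
    where
    A = 𝔽ˢ q la nu κ P
    B = 𝔽ˢ q nu mu κ′ P′
    N = negPow (s P) la
    C = 𝖼 q (s P) la
    N′ = negPow (s P′) nu
    C′ = 𝖼 q (s P′) nu
    N″ = negPow (s (τ k P′)) mu
    C″ = 𝖼 q (s (τ k P′)) mu
    S≡ : ∀ i → s (τ (m ℕ.+ k) P) i ≡ s (τ k P′) i
    S≡ i = ≡.sym (proj₂ (τ-τ m k P i))
    N′#0 : N′ # 0#
    N′#0 = negPow-τ#0 q √ξ √s √ξ#0 √s#0 m nu
    C′#0 : C′ # 0#
    C′#0 = 𝖼-τ#0 q √ξ √s √ξ#0 √s#0 m q-generic (s-generic m) nu
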